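{- For every $n\ge1$, \[\sum_{\pi\in\mathcal A_n}\mathbf x^{\operatorname{cDes}(\pi)}=\sum_{k=0}^{n-2}\ \sum_{T\in\operatorname{SYT}((n-k-1,1^k)\oplus(1))}\mathbf x^{\operatorname{cDes}(T)}.\]
   Context: A permutation $\pi\in\mathfrak S_n$ is an arc permutation if for every $1\le j\le n$ the set $\{\pi(1),\dots,\pi(j)\}$ is an interval in $\mathbb Z_n$; $\mathcal A_n$ is the set of arc permutations. For $\pi\in\mathfrak S_n$, $\operatorname{cDes}(\pi)=\{i\in[n]:\pi(i)>\pi(i+1)\}$ with $\pi(n+1):=\pi(1)$; $\mathbf x^S=\prod_{i\in S}x_i$. The skew shape $(n-k-1,1^k)\oplus(1)$ consists of the hook diagram $(n-k-1,1^k)$ together with one additional disconnected cell placed northeast of it (in English notation). For a standard Young tableau $T$ of this shape, $\operatorname{Des}(T)=\{i\in[n-1]: i+1$ is in a lower row than $i$ in $T\}$, and $\operatorname{cDes}(T)=\operatorname{Des}(T)\cup\{n\}$ if $|\operatorname{Des}(T)|=k$, and $\operatorname{cDes}(T)=\operatorname{Des}(T)$ otherwise.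
   Formalization: The identity is proved for n ≥ 2, as a bijection for each set S; at n = 1 it fails as written, since the left side is 1 (the single permutation has empty cyclic descent set) and the right side is an empty sum. -}

module Defs where

open import Data.Nat using (ℕ; zero; suc; _∸_; _<_; _≤_; _<ᵇ_; _≡ᵇ_)
open import Data.Nat.DivMod using (_mod_)
open import Data.Bool using (Bool; true; false; _∧_; _∨_)
open import Data.Fin using (Fin; toℕ)
open import Data.Fin.Subset using (Subset; ∣_∣)
open import Data.Vec using (Vec; []; _∷_; lookup; tabulate)
open import Data.Product using (Σ; ∃; _×_; _,_; proj₁; proj₂)
open import Data.Sum using (_⊎_)
open import Relation.Binary.PropositionalEquality using (_≡_; _≢_)
open import Function.Bundles using (_⇔_)

-- Conventions.
-- * [n] = {1,…,n} is represented by Fin n, the element i : Fin n standing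
--   for i+1 (likewise values of permutations are shifted by one, which does
--   not affect any comparison).
-- * A squarefree monomial x^S, S ⊆ [n], is represented by S : Subset n.

csuc : ∀ {n} → Fin n → Fin n
csuc {suc m} i = suc (toℕ i) mod (suc m)

_+ᶜ_ : ∀ {n} → Fin n → ℕ → Fin n
a +ᶜ zero  = a
a +ᶜ suc t = csuc (a +ᶜ t)

IsCycInterval : (n : ℕ) → (Fin n → Set) → Set
IsCycInterval n P =
  Σ (Fin n) λ a → Σ ℕ λ m → ∀ x → P x ⇔ (Σ ℕ λ t → t < m × x ≡ a +ᶜ t)

-- π given in one-line notation (π(i+1) = lookup π i)
IsPerm : ∀ {n} → Vec (Fin n) n → Set
IsPerm π = ∀ i j → lookup π i ≡ lookup π j → i ≡ j

prefixSet : ∀ {n} → Vec (Fin n) n → ℕ → Fin n → Set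
prefixSet π j x = Σ _ λ i → toℕ i < j × lookup π i ≡ x

IsArc : ∀ {n} → Vec (Fin n) n → Set
IsArc {n} π = ∀ j → 1 ≤ j → j ≤ n → IsCycInterval n (prefixSet π j)

record ArcPerm (n : ℕ) : Set where
  constructor arcPerm
  field
    perm    : Vec (Fin n) n
    .isPerm : IsPerm perm
    .isArc  : IsArc perm
open ArcPerm public

cDes : ∀ {n} → Vec (Fin n) n → Subset n
cDes π = tabulate λ i → toℕ (lookup π (csuc i)) <ᵇ toℕ (lookup π i)

-- The skew shape (n-k-1, 1^k) ⊕ (1), cells (row , column), 0-indexed,
-- rows numbered from the top (English notation):
--   the extra cell (0 , n-k-1)  (northeast, disconnected),
--   the hook's first row (1 , c) for c < n-k-1,
--   the hook's leg       (r , 0) for 2 ≤ r ≤ k+1.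

InShape : ℕ → ℕ → ℕ × ℕ → Set
InShape n k (r , c) =
    (r ≡ 0 × c ≡ n ∸ k ∸ 1)
  ⊎ (r ≡ 1 × c < n ∸ k ∸ 1)
  ⊎ (2 ≤ r × r ≤ suc k × c ≡ 0)

-- A standard Young tableau of shape (n-k-1,1^k) ⊕ (1): pos gives the cell
-- containing the entry i+1 (lookup pos i).  Entries fill distinct cells of
-- the shape (n entries, n cells, hence a bijection) and increase along rows
-- (left to right) and columns (top to bottom).
record SYT (n k : ℕ) : Set where
  constructor syt
  field
    pos       : Vec (ℕ × ℕ) n
    .inShape  : ∀ i → InShape n k (lookup pos i)
    .distinct : ∀ i j → lookup pos i ≡ lookup pos j → i ≡ j
    .rowInc   : ∀ i j → toℕ i < toℕ j →
                proj₁ (lookup pos i) ≡ proj₁ (lookup pos j) →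
                proj₂ (lookup pos i) < proj₂ (lookup pos j)
    .colInc   : ∀ i j → toℕ i < toℕ j →
                proj₂ (lookup pos i) ≡ proj₂ (lookup pos j) →
                proj₁ (lookup pos i) < proj₁ (lookup pos j)
open SYT public

-- row of the entry (i+1), by natural-number index (0 if out of range)
rowAt : ∀ {n} → Vec (ℕ × ℕ) n → ℕ → ℕ
rowAt []       _       = 0
rowAt (x ∷ xs) zero    = proj₁ x
rowAt (x ∷ xs) (suc i) = rowAt xs i

DesT : ∀ {n k} → SYT n k → Subset n
DesT {n} T = tabulate λ i →
  (suc (toℕ i) <ᵇ n) ∧ (rowAt (pos T) (toℕ i) <ᵇ rowAt (pos T) (suc (toℕ i)))

cDesT : ∀ {n k} → SYT n k → Subset n
cDesT {n} {k} T = tabulate λ i →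
  lookup (DesT T) i ∨ ((suc (toℕ i) ≡ᵇ n) ∧ (∣ DesT T ∣ ≡ᵇ k))

{-# OPTIONS --safe #-}

-- Both sides count, for a fixed cyclic descent set S, the starts of the cyclic
-- runs of S: the e with e ∈ S and e − 1 ∉ S.
--
-- An arc permutation π is sent to the position e of its maximum. Up to e each
-- prefix is an ordinary interval of values and after e each remaining set of
-- values is one, so every comparison between two values of π can be read off
-- (S, e); conversely the comparisons prescribed by any (S, e) define an arc
-- permutation.
--
-- A tableau T is sent to its entry e in the disconnected cell. If L is the set
-- of entries in the leg, then i < n is a cyclic descent iff i + 1 ∈ L or i = e,
-- and n is one iff e = n or e + 1 ∈ L. Hence (S, e) determines L, and (L, e)
-- determines T.
module Submission where

open import Defs
open import Axiom.UniquenessOfIdentityProofs.WithK using (uip)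
open import Data.Bool using (Bool; true; false; not; if_then_else_; _∧_; _∨_)
open import Data.Bool.Properties using (T-≡; not-involutive; ∨-identityʳ; ∨-zeroʳ; ∧-identityʳ; ∧-zeroʳ)
import Data.Bool.Properties as Bool
open import Data.Empty using (⊥; ⊥-elim)
open import Data.Empty.Irrelevant using () renaming (⊥-elim to ⊥-elim-irr)
open import Data.Fin using (Fin; zero; suc; toℕ; fromℕ; fromℕ<; inject₁; punchOut)
open import Data.Fin.Permutation using (Permutation; permutation)
open import Data.Fin.Properties using (toℕ-injective; toℕ<n; toℕ≤pred[n]; toℕ-fromℕ<; toℕ-fromℕ; toℕ-inject₁; any?; punchOut-injective; <⇒notInjective)
import Data.Fin.Properties as Fin
open import Data.Fin.Relation.Unary.Top using (view; ‵fromℕ; ‵inject₁)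
open import Data.Fin.Subset using (Subset; ∣_∣)
open import Data.Nat
open import Data.Nat.DivMod
open import Data.Nat.Properties
open import Data.Product using (Σ; ∃; _×_; _,_; proj₁; proj₂)
import Data.Product.Properties as Product
open import Data.Sum using (_⊎_; inj₁; inj₂)
open import Data.Vec using (Vec; _∷_; lookup; tabulate)
open import Data.Vec.Properties using (≡-dec; lookup∘tabulate; tabulate∘lookup; tabulate-cong)
open import Function using (_∘_; Equivalence; _⇔_; mk⇔)
open import Function.Bundles using (_↔_; mk↔ₛ′)
open import Function.Construct.Composition using (_↔-∘_)
open import Function.Construct.Symmetry using (↔-sym)
open import Relation.Binary.Definitions using (Tri; tri<; tri≈; tri>)
open import Relation.Binary.PropositionalEquality
open import Relation.Nullary using (¬_; Dec; yes; no; does; contradiction)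
open import Relation.Nullary.Decidable using (¬?; recompute; decidable-stable; _×-dec_; dec-true; dec-false)
open import Algebra.Properties.CommutativeMonoid.Sum +-0-commutativeMonoid using (sum; sum-permute)

-- Both kinds of object are rebuilt from `(S, e)` by one mechanism. The pair fixes a strict
-- direction for every two positions; an injective numbering of `n` things by `Fin n` equals its own
-- ranks, so it is determined by these directions; and a key in ℕ with the right directions,
-- replaced by its ranks, shows existence. For a permutation the numbering is the permutation
-- itself, for a tableau it numbers the cells row by row. The maximum is the right reference point
-- because a cyclic interval without the largest value cannot wrap around, and the complement of one
-- that contains it cannot either. Cyclic intervals thus turn into convexity in the usual order. The
-- condition `e − 1 ∉ S` does different work on the two sides. For a permutation it says that the
-- step into the maximum goes up. For a tableau it keeps `e` out of the leg and leaves an entry for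
-- the corner of the hook that precedes the whole leg; this also yields `k ≤ n − 2`.

<⇒<ᵇ≡true : ∀ {x y} → x < y → (x <ᵇ y) ≡ true
<⇒<ᵇ≡true x<y = Equivalence.to T-≡ (<⇒<ᵇ x<y)

<ᵇ≡true⇒< : ∀ {x y} → (x <ᵇ y) ≡ true → x < y
<ᵇ≡true⇒< {x} {y} eq = <ᵇ⇒< x y (Equivalence.from T-≡ eq)

≤⇒<ᵇ≡false : ∀ {x y} → y ≤ x → (x <ᵇ y) ≡ false
≤⇒<ᵇ≡false {x} {y} y≤x with x <ᵇ y in eq
... | false = refl
... | true  = contradiction (<ᵇ≡true⇒< eq) (≤⇒≯ y≤x)

-- Counting and ranks

# : ∀ {n} → (Fin n → Bool) → ℕ
# f = ∣ tabulate f ∣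

#-cong : ∀ {n} {f g : Fin n → Bool} → f ≗ g → # f ≡ # g
#-cong f≗g = cong ∣_∣ (tabulate-cong f≗g)

#-mono : ∀ {n} {f g : Fin n → Bool} → (∀ i → f i ≡ true → g i ≡ true) → # f ≤ # g
#-mono {zero}          f⊆g = z≤n
#-mono {suc n} {f} {g} f⊆g with f zero in f₀ | g zero in g₀
... | false | false = #-mono (f⊆g ∘ suc)
... | false | true  = m≤n⇒m≤1+n (#-mono (f⊆g ∘ suc))
... | true  | true  = s≤s (#-mono (f⊆g ∘ suc))
... | true  | false = contradiction (trans (sym g₀) (f⊆g zero f₀)) λ ()

#-mono-< : ∀ {n} {f g : Fin n → Bool} → (∀ i → f i ≡ true → g i ≡ true) →
           ∀ i → f i ≡ false → g i ≡ true → # f < # g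
#-mono-< {suc n} {f} {g} f⊆g zero f₀ g₀ rewrite f₀ | g₀ = s≤s (#-mono (f⊆g ∘ suc))
#-mono-< {suc n} {f} {g} f⊆g (suc i) fᵢ gᵢ with f zero in f₀ | g zero in g₀
... | false | false = #-mono-< (f⊆g ∘ suc) i fᵢ gᵢ
... | false | true  = m≤n⇒m≤1+n (#-mono-< (f⊆g ∘ suc) i fᵢ gᵢ)
... | true  | true  = s≤s (#-mono-< (f⊆g ∘ suc) i fᵢ gᵢ)
... | true  | false = contradiction (trans (sym g₀) (f⊆g zero f₀)) λ ()

#-not : ∀ {n} (f : Fin n → Bool) → # (not ∘ f) + # f ≡ n
#-not {zero}  f = refl
#-not {suc n} f with f zero
... | false = cong suc (#-not (f ∘ suc))
... | true  = trans (+-suc _ _) (cong suc (#-not (f ∘ suc)))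

#-none : ∀ n → # {n} (λ _ → false) ≡ 0
#-none zero    = refl
#-none (suc n) = #-none n

#-all : ∀ n → # {n} (λ _ → true) ≡ n
#-all zero    = refl
#-all (suc n) = cong suc (#-all n)

#-initial : ∀ {n} t → t ≤ n → # {n} (λ i → toℕ i <ᵇ t) ≡ t
#-initial {n} zero    _         = #-none n
#-initial     (suc t) (s≤s t≤n) = cong suc (#-initial t t≤n)

#-as-sum : ∀ {n} (f : Fin n → Bool) → # f ≡ sum (λ i → if f i then 1 else 0)
#-as-sum {zero}  f = refl
#-as-sum {suc n} f with f zero
... | false = #-as-sum (f ∘ suc)
... | true  = cong suc (#-as-sum (f ∘ suc))

Inj : ∀ {a b} {A : Set a} {B : Set b} → (A → B) → Set _
Inj f = ∀ i j → f i ≡ f j → i ≡ j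

-- If `y` were missed, punching it out of the codomain would inject `suc n` elements into `n`.
injective⇒surjective : ∀ {n} {f : Fin n → Fin n} → Inj f → ∀ y → ∃ λ i → f i ≡ y
injective⇒surjective {suc n} {f} inj y with any? (λ i → f i Fin.≟ y)
... | yes hit = hit
... | no miss = ⊥-elim (<⇒notInjective {f = λ i → punchOut (avoid i)} (n<1+n n)
                  λ {i} {j} eq → inj i j (punchOut-injective (avoid i) (avoid j) eq))
  where
  avoid : ∀ i → y ≢ f i
  avoid i y≡fi = miss (i , sym y≡fi)

#-permute : ∀ {n} {f : Fin n → Fin n} → Inj f → (P : Fin n → Bool) → # (P ∘ f) ≡ # P
#-permute {n} {f} inj P = begin
  # (P ∘ f)                               ≡⟨ #-as-sum (P ∘ f) ⟩
  sum (λ i → if P (f i) then 1 else 0)    ≡⟨ sum-permute (λ i → if P i then 1 else 0) σ ⟨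
  sum (λ i → if P i then 1 else 0)        ≡⟨ #-as-sum P ⟨
  # P                                     ∎
  where
  open ≡-Reasoning
  f⁻¹ : Fin n → Fin n
  f⁻¹ y = proj₁ (injective⇒surjective inj y)
  f-f⁻¹ : ∀ y → f (f⁻¹ y) ≡ y
  f-f⁻¹ y = proj₂ (injective⇒surjective inj y)
  σ : Permutation n n
  σ = permutation f f⁻¹ f-f⁻¹ (λ i → inj _ _ (f-f⁻¹ (f i)))

-- Order patterns and their ranks

Dir : Bool → ℕ → ℕ → Set
Dir true  x y = x < y
Dir false x y = y < x

Dir-flip : ∀ b {x y} → Dir b x y → Dir (not b) y x
Dir-flip true  d = d
Dir-flip false d = d

Dir-≢ : ∀ b {x y} → Dir b x y → x ≢ y
Dir-≢ true  d refl = <-irrefl refl d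
Dir-≢ false d refl = <-irrefl refl d

Dir-map : ∀ b {x y} {x′ y′} → (x < y → x′ < y′) → (y < x → y′ < x′) → Dir b x y → Dir b x′ y′
Dir-map true  up down = up
Dir-map false up down = down

Dir-<ᵇ : ∀ b {x y} → Dir b x y → (x <ᵇ y) ≡ b
Dir-<ᵇ true  x<y = <⇒<ᵇ≡true x<y
Dir-<ᵇ false y<x = ≤⇒<ᵇ≡false (<⇒≤ y<x)

<ᵇ-Dir : ∀ {x y} → x ≢ y → Dir (x <ᵇ y) x y
<ᵇ-Dir {x} {y} x≢y with <-cmp x y
... | tri< x<y _ _ rewrite <⇒<ᵇ≡true x<y = x<y
... | tri≈ _ x≡y _ = contradiction x≡y x≢y
... | tri> _ _ y<x rewrite ≤⇒<ᵇ≡false (<⇒≤ y<x) = y<x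

-- A strict direction shared by both functions, rather than an equivalence of comparisons, also
-- forces both to be injective.
SameOrder : ∀ {n} → (f g : Fin n → ℕ) → Set
SameOrder f g = ∀ i j → toℕ i < toℕ j → ∃ λ b → Dir b (f i) (f j) × Dir b (g i) (g j)

SameOrder-swap : ∀ {n} {f g : Fin n → ℕ} → SameOrder f g → SameOrder g f
SameOrder-swap s i j i<j with s i j i<j
... | b , df , dg = b , dg , df

SameOrder⇒injective : ∀ {n} {f g : Fin n → ℕ} → SameOrder f g → Inj f
SameOrder⇒injective s i j eq with <-cmp (toℕ i) (toℕ j)
... | tri< i<j _ _ with b , df , _ ← s i j i<j = contradiction eq (Dir-≢ b df)
... | tri≈ _ i≡j _ = toℕ-injective i≡j
... | tri> _ _ j<i with b , df , _ ← s j i j<i = contradiction (sym eq) (Dir-≢ b df)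

SameOrder⇒< : ∀ {n} {f g : Fin n → ℕ} → SameOrder f g → ∀ i j → f i < f j → g i < g j
SameOrder⇒< s i j fi<fj with <-cmp (toℕ i) (toℕ j)
... | tri< i<j _ _ with s i j i<j
...   | true  , _  , dg = dg
...   | false , df , _  = contradiction fi<fj (<-asym df)
SameOrder⇒< s i j fi<fj | tri≈ _ i≡j _ with refl ← toℕ-injective i≡j = contradiction fi<fj (<-irrefl refl)
SameOrder⇒< s i j fi<fj | tri> _ _ j<i with s j i j<i
...   | false , _  , dg = dg
...   | true  , df , _  = contradiction fi<fj (<-asym df)

rank : ∀ {n} → (Fin n → ℕ) → Fin n → ℕ
rank f i = # (λ j → f j <ᵇ f i)

rank-mono-< : ∀ {n} (f : Fin n → ℕ) {i j} → f i < f j → rank f i < rank f j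
rank-mono-< f {i} fi<fj =
  #-mono-< (λ p eq → <⇒<ᵇ≡true (<-trans (<ᵇ≡true⇒< {f p} eq) fi<fj)) i (≤⇒<ᵇ≡false (≤-refl {f i})) (<⇒<ᵇ≡true fi<fj)

rank<n : ∀ {n} (f : Fin n → ℕ) i → rank f i < n
rank<n {n} f i = subst (rank f i <_) (#-all n) (#-mono-< (λ _ _ → refl) i (≤⇒<ᵇ≡false (≤-refl {f i})) refl)

rank-Dir : ∀ {n} (f : Fin n → ℕ) b {i j} → Dir b (f i) (f j) → Dir b (rank f i) (rank f j)
rank-Dir f b = Dir-map b (rank-mono-< f) (rank-mono-< f)

rank-cong : ∀ {n} {f g : Fin n → ℕ} → SameOrder f g → ∀ i → rank f i ≡ rank g i
rank-cong {f = f} {g} s i = ≤-antisym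
  (#-mono λ j eq → <⇒<ᵇ≡true (SameOrder⇒< s j i (<ᵇ≡true⇒< {f j} eq)))
  (#-mono λ j eq → <⇒<ᵇ≡true (SameOrder⇒< (SameOrder-swap s) j i (<ᵇ≡true⇒< {g j} eq)))

-- An injection of `Fin n` into itself takes each value once, so exactly `toℕ (f i)` positions carry
-- a value below `f i`.
rank-perm : ∀ {n} {f : Fin n → Fin n} → Inj f → ∀ i → rank (toℕ ∘ f) i ≡ toℕ (f i)
rank-perm {f = f} inj i =
  trans (#-permute inj (λ v → toℕ v <ᵇ toℕ (f i))) (#-initial (toℕ (f i)) (<⇒≤ (toℕ<n (f i))))

SameOrder⇒≗ : ∀ {n} {f g : Fin n → Fin n} → SameOrder (toℕ ∘ f) (toℕ ∘ g) → f ≗ g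
SameOrder⇒≗ {f = f} {g} s i = toℕ-injective (begin
  toℕ (f i)          ≡⟨ rank-perm (toℕ-inj s) i ⟨
  rank (toℕ ∘ f) i   ≡⟨ rank-cong s i ⟩
  rank (toℕ ∘ g) i   ≡⟨ rank-perm (toℕ-inj (SameOrder-swap s)) i ⟩
  toℕ (g i)          ∎)
  where
  open ≡-Reasoning
  toℕ-inj : ∀ {f g : Fin _ → Fin _} → SameOrder (toℕ ∘ f) (toℕ ∘ g) → Inj f
  toℕ-inj s i j eq = SameOrder⇒injective s i j (cong toℕ eq)

-- Cyclic intervals

toℕ-+ᶜ : ∀ {n} (a : Fin (suc n)) t → toℕ (a +ᶜ t) ≡ (toℕ a + t) % suc n
toℕ-+ᶜ {n} a zero = sym (trans (cong (_% suc n) (+-identityʳ (toℕ a))) (m<n⇒m%n≡m (toℕ<n a)))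
toℕ-+ᶜ {n} a (suc t) = begin
  toℕ (csuc (a +ᶜ t))                        ≡⟨ toℕ-fromℕ< _ ⟩
  suc (toℕ (a +ᶜ t)) % suc n                 ≡⟨ cong (λ s → suc s % suc n) (toℕ-+ᶜ a t) ⟩
  suc ((toℕ a + t) % suc n) % suc n          ≡⟨ %-remove-mod (toℕ a + t) ⟩
  suc (toℕ a + t) % suc n                    ≡⟨ cong (_% suc n) (+-suc (toℕ a) t) ⟨
  (toℕ a + suc t) % suc n                    ∎
  where
  open ≡-Reasoning
  %-remove-mod : ∀ s → suc (s % suc n) % suc n ≡ suc s % suc n
  %-remove-mod s = begin
    suc (s % suc n) % suc n                              ≡⟨ [m+kn]%n≡m%n (suc (s % suc n)) (s / suc n) (suc n) ⟨
    (suc (s % suc n) + s / suc n * suc n) % suc n        ≡⟨ cong (λ r → suc r % suc n) (m≡m%n+[m/n]*n s (suc n)) ⟨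
    suc s % suc n                                        ∎

-- The cyclic interval of length `m` from `a` as linear inequalities: the second disjunct is a point
-- reached after a full turn, as `x + n`.
InArc : ℕ → ℕ → ℕ → ℕ → Set
InArc n a m x = (a ≤ x × x < a + m) ⊎ (x < a × x + n < a + m)

+ᶜ⇒InArc : ∀ {n} (a x : Fin (suc n)) {m} →
           (Σ ℕ λ t → t < m × x ≡ a +ᶜ t) → InArc (suc n) (toℕ a) m (toℕ x)
+ᶜ⇒InArc {n} a x {m} (t , t<m , x≡a+t) = locate (toℕ a ≤? toℕ x)
  where
  q = (toℕ a + t) / suc n
  a+t≡x+qn : toℕ a + t ≡ toℕ x + q * suc n
  a+t≡x+qn = trans (m≡m%n+[m/n]*n (toℕ a + t) (suc n))
                   (cong (_+ q * suc n) (sym (trans (cong toℕ x≡a+t) (toℕ-+ᶜ a t))))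
  a+t<a+m : toℕ a + t < toℕ a + m
  a+t<a+m = +-monoʳ-< (toℕ a) t<m
  -- A point below `a` is reached only after a full turn, so the quotient is nonzero.
  wraps : ∀ q → toℕ x < toℕ a → toℕ a + t ≡ toℕ x + q * suc n → toℕ x + suc n ≤ toℕ a + t
  wraps zero    x<a eq = contradiction (≤-trans (m≤m+n (toℕ a) t) (≤-reflexive (trans eq (+-identityʳ (toℕ x))))) (<⇒≱ x<a)
  wraps (suc q) x<a eq = ≤-trans (+-monoʳ-≤ (toℕ x) (m≤m+n (suc n) (q * suc n))) (≤-reflexive (sym eq))
  locate : Dec (toℕ a ≤ toℕ x) → InArc (suc n) (toℕ a) m (toℕ x)
  locate (yes a≤x) = inj₁ (a≤x , ≤-<-trans (subst (toℕ x ≤_) (sym a+t≡x+qn) (m≤m+n (toℕ x) _)) a+t<a+m)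
  locate (no a≰x)  = inj₂ (≰⇒> a≰x , ≤-<-trans (wraps q (≰⇒> a≰x) a+t≡x+qn) a+t<a+m)

InArc⇒+ᶜ : ∀ {n} (a x : Fin (suc n)) {m} →
           InArc (suc n) (toℕ a) m (toℕ x) → Σ ℕ λ t → t < m × x ≡ a +ᶜ t
InArc⇒+ᶜ {n} a x {m} (inj₁ (a≤x , x<a+m)) =
  toℕ x ∸ toℕ a , +-cancelˡ-< (toℕ a) _ _ (subst (_< toℕ a + m) (sym (m+[n∸m]≡n a≤x)) x<a+m) ,
  toℕ-injective (sym (begin
    toℕ (a +ᶜ (toℕ x ∸ toℕ a))             ≡⟨ toℕ-+ᶜ a _ ⟩
    (toℕ a + (toℕ x ∸ toℕ a)) % suc n      ≡⟨ cong (_% suc n) (m+[n∸m]≡n a≤x) ⟩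
    toℕ x % suc n                          ≡⟨ m<n⇒m%n≡m (toℕ<n x) ⟩
    toℕ x                                  ∎))
  where open ≡-Reasoning
InArc⇒+ᶜ {n} a x {m} (inj₂ (_ , x+n<a+m)) =
  t , +-cancelˡ-< (toℕ a) _ _ (subst (_< toℕ a + m) (sym a+t≡x+n) x+n<a+m) ,
  toℕ-injective (sym (begin
    toℕ (a +ᶜ t)               ≡⟨ toℕ-+ᶜ a _ ⟩
    (toℕ a + t) % suc n        ≡⟨ cong (_% suc n) a+t≡x+n ⟩
    (toℕ x + suc n) % suc n    ≡⟨ [m+n]%n≡m%n (toℕ x) (suc n) ⟩
    toℕ x % suc n              ≡⟨ m<n⇒m%n≡m (toℕ<n x) ⟩
    toℕ x                      ∎))
  where
  open ≡-Reasoning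
  t = toℕ x + suc n ∸ toℕ a
  a+t≡x+n : toℕ a + t ≡ toℕ x + suc n
  a+t≡x+n = m+[n∸m]≡n (≤-trans (<⇒≤ (toℕ<n a)) (m≤n+m (suc n) (toℕ x)))

IsArcSet : ∀ {n} → (Fin n → Set) → Set
IsArcSet {n} P = Σ (Fin n) λ a → Σ ℕ λ m → ∀ x → P x ⇔ InArc n (toℕ a) m (toℕ x)

IsCycInterval⇒IsArcSet : ∀ {n} {P : Fin (suc n) → Set} → IsCycInterval (suc n) P → IsArcSet P
IsCycInterval⇒IsArcSet (a , m , P⇔) = a , m , λ x →
  mk⇔ (+ᶜ⇒InArc a x ∘ Equivalence.to (P⇔ x)) (Equivalence.from (P⇔ x) ∘ InArc⇒+ᶜ a x)

IsArcSet⇒IsCycInterval : ∀ {n} {P : Fin (suc n) → Set} → IsArcSet P → IsCycInterval (suc n) P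
IsArcSet⇒IsCycInterval (a , m , P⇔) = a , m , λ x →
  mk⇔ (InArc⇒+ᶜ a x ∘ Equivalence.to (P⇔ x)) (Equivalence.from (P⇔ x) ∘ +ᶜ⇒InArc a x)

outside-high : ∀ {n a m x} → ¬ InArc n a m x → a ≤ x → a + m ≤ x
outside-high x∉ a≤x = ≮⇒≥ λ x<a+m → x∉ (inj₁ (a≤x , x<a+m))

outside-low : ∀ {n a m x} → ¬ InArc n a m x → x < a → a + m ≤ x + n
outside-low x∉ x<a = ≮⇒≥ λ x+n<a+m → x∉ (inj₂ (x<a , x+n<a+m))

-- Four points in cyclic order cannot alternate between an interval and its complement. In the
-- application `w` is the largest value; lying outside, it makes the interval convex.
noncrossing-in-out : ∀ {n a m x y z w} → x < y → y < z → z < w → w < n →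
  InArc n a m x → ¬ InArc n a m y → InArc n a m z → ¬ InArc n a m w → ⊥
noncrossing-in-out {a = a} x<y y<z z<w w<n (inj₁ (a≤x , _)) y∉ z∈ w∉ with z∈
... | inj₁ (_ , z<a+m) = <-irrefl refl (≤-<-trans (outside-high y∉ (<⇒≤ (≤-<-trans a≤x x<y))) (<-trans y<z z<a+m))
... | inj₂ (z<a , _)   = <-irrefl refl (≤-<-trans a≤x (<-trans x<y (<-trans y<z z<a)))
-- Here `x` is reached by wrapping, so every point from `a` up to `n` belongs to the interval.
noncrossing-in-out {n} {a} {m} {x} {y} {z} {w} x<y y<z z<w w<n (inj₂ (x<a , x+n<a+m)) y∉ z∈ w∉ with a ≤? y
... | yes a≤y = <-irrefl refl (≤-<-trans (m≤n+m n x) (<-trans x+n<a+m (≤-<-trans (outside-high y∉ a≤y) (<-trans y<z (<-trans z<w w<n)))))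
... | no a≰y with z∈
...   | inj₁ (a≤z , _)     = <-irrefl refl (≤-<-trans (m≤n+m n x) (<-trans x+n<a+m
                               (≤-<-trans (outside-high w∉ (<⇒≤ (≤-<-trans a≤z z<w))) w<n)))
...   | inj₂ (_ , z+n<a+m) = <-asym y<z (+-cancelʳ-< n z y (<-≤-trans z+n<a+m (outside-low y∉ (≰⇒> a≰y))))

-- The opposite alternation, applied with the largest value `w` inside: the complement is then
-- convex.
noncrossing-out-in : ∀ {n a m x y z w} → x < y → y < z → z < w →
  ¬ InArc n a m x → InArc n a m y → ¬ InArc n a m z → InArc n a m w → ⊥
noncrossing-out-in x<y y<z z<w x∉ (inj₁ (a≤y , _)) z∉ (inj₁ (_ , w<a+m)) =
  <-irrefl refl (≤-<-trans (outside-high z∉ (<⇒≤ (≤-<-trans a≤y y<z))) (<-trans z<w w<a+m))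
noncrossing-out-in x<y y<z z<w x∉ (inj₁ (a≤y , _)) z∉ (inj₂ (w<a , _)) =
  <-irrefl refl (≤-<-trans a≤y (<-trans y<z (<-trans z<w w<a)))
noncrossing-out-in {n} {x = x} {y} x<y y<z z<w x∉ (inj₂ (y<a , y+n<a+m)) z∉ w∈ =
  <-asym x<y (+-cancelʳ-< n y x (<-≤-trans y+n<a+m (outside-low x∉ (<-trans x<y y<a))))

Convex : ∀ {n} → (Fin n → Set) → Set
Convex P = ∀ x y z → toℕ x < toℕ y → toℕ y < toℕ z → P x → P z → P y

extrema : ∀ {n} {P : Fin n → Set} → (∀ x → Dec (P x)) →
  (∀ x → ¬ P x) ⊎
  (Σ (Fin n) λ lo → Σ (Fin n) λ hi → P lo × P hi × (∀ x → P x → toℕ lo ≤ toℕ x × toℕ x ≤ toℕ hi))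
extrema {zero}  P? = inj₁ λ ()
extrema {suc n} P? with extrema (P? ∘ suc) | P? zero
... | inj₁ none | no ¬P₀ = inj₁ λ { zero → ¬P₀ ; (suc x) → none x }
... | inj₁ none | yes P₀ = inj₂ (zero , zero , P₀ , P₀ ,
        λ { zero _ → z≤n , z≤n ; (suc x) Px → contradiction Px (none x) })
... | inj₂ (lo , hi , Plo , Phi , bd) | no ¬P₀ = inj₂ (suc lo , suc hi , Plo , Phi ,
        λ { zero P₀ → contradiction P₀ ¬P₀
          ; (suc x) Px → s≤s (proj₁ (bd x Px)) , s≤s (proj₂ (bd x Px)) })
... | inj₂ (lo , hi , Plo , Phi , bd) | yes P₀ = inj₂ (zero , suc hi , P₀ , Phi ,
        λ { zero _ → z≤n , z≤n ; (suc x) Px → z≤n , s≤s (proj₂ (bd x Px)) })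

between-extrema : ∀ {n} {P : Fin n → Set} → Convex P → ∀ {lo hi} → P lo → P hi →
  ∀ x → toℕ lo ≤ toℕ x → toℕ x ≤ toℕ hi → P x
between-extrema {P = P} convex {lo} {hi} Plo Phi x lo≤x x≤hi with m≤n⇒m<n∨m≡n lo≤x | m≤n⇒m<n∨m≡n x≤hi
... | inj₂ lo≡x | _         = subst P (toℕ-injective lo≡x) Plo
... | inj₁ _    | inj₂ x≡hi = subst P (sym (toℕ-injective x≡hi)) Phi
... | inj₁ lo<x | inj₁ x<hi = convex lo x hi lo<x x<hi Plo Phi

convex⇒IsArcSet : ∀ {n} {P : Fin (suc n) → Set} → (∀ x → Dec (P x)) → Convex P → IsArcSet P
convex⇒IsArcSet {n} {P} P? convex with extrema P?
... | inj₁ none = zero , 0 , λ x → mk⇔ (λ Px → contradiction Px (none x)) λ { (inj₁ (_ , ())) ; (inj₂ (() , _)) }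
... | inj₂ (lo , hi , Plo , Phi , bd) = lo , suc (toℕ hi ∸ toℕ lo) , λ x → mk⇔ (to x) (from x)
  where
  end : toℕ lo + suc (toℕ hi ∸ toℕ lo) ≡ suc (toℕ hi)
  end = trans (+-suc _ _) (cong suc (m+[n∸m]≡n (proj₁ (bd hi Phi))))
  to : ∀ x → P x → InArc (suc n) (toℕ lo) (suc (toℕ hi ∸ toℕ lo)) (toℕ x)
  to x Px = inj₁ (proj₁ (bd x Px) , subst (toℕ x <_) (sym end) (s≤s (proj₂ (bd x Px))))
  from : ∀ x → InArc (suc n) (toℕ lo) (suc (toℕ hi ∸ toℕ lo)) (toℕ x) → P x
  from x (inj₁ (lo≤x , x<)) = between-extrema convex Plo Phi x lo≤x (s≤s⁻¹ (subst (toℕ x <_) end x<))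
  from x (inj₂ (_ , x+n<)) = contradiction
    (≤-<-trans (m≤n+m (suc n) (toℕ x)) (subst (toℕ x + suc n <_) end x+n<)) (≤⇒≯ (toℕ<n hi))

-- The complement runs from `lo` to `hi`, so the set starts just after `hi`, wraps around and stops
-- before `lo`.
coconvex⇒IsArcSet : ∀ {n} {P : Fin (suc n) → Set} → (∀ x → Dec (P x)) → Convex (¬_ ∘ P) → IsArcSet P
coconvex⇒IsArcSet {n} {P} P? convex with extrema (λ x → ¬? (P? x))
... | inj₁ none = zero , suc n , λ x → mk⇔ (λ _ → inj₁ (z≤n , toℕ<n x)) (λ _ → decidable-stable (P? x) (none x))
... | inj₂ (lo , hi , ¬lo , ¬hi , bd) with toℕ hi <? n
-- If `hi` is the last point there is no successor to start from; the set is then the initial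
-- segment below `lo`.
...   | no hi≮n = zero , toℕ lo , λ x → mk⇔ (to x) (from x)
  where
  to : ∀ x → P x → InArc (suc n) 0 (toℕ lo) (toℕ x)
  to x Px = inj₁ (z≤n , ≰⇒> λ lo≤x →
    between-extrema convex ¬lo ¬hi x lo≤x (≤-trans (s≤s⁻¹ (toℕ<n x)) (≮⇒≥ hi≮n)) Px)
  from : ∀ x → InArc (suc n) 0 (toℕ lo) (toℕ x) → P x
  from x (inj₁ (_ , x<lo)) = decidable-stable (P? x) λ ¬x → <⇒≱ x<lo (proj₁ (bd x ¬x))
...   | yes hi<n = fromℕ< (s≤s hi<n) , suc n ∸ suc (toℕ hi) + toℕ lo , λ x →
    subst (λ a → P x ⇔ InArc (suc n) a (suc n ∸ suc (toℕ hi) + toℕ lo) (toℕ x)) (sym (toℕ-fromℕ< (s≤s hi<n)))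
      (mk⇔ (to x) (from x))
  where
  M : ℕ
  M = suc n ∸ suc (toℕ hi) + toℕ lo
  end : suc (toℕ hi) + M ≡ toℕ lo + suc n
  end = trans (sym (+-assoc (suc (toℕ hi)) _ _))
        (trans (cong (_+ toℕ lo) (m+[n∸m]≡n (s≤s (<⇒≤ hi<n)))) (+-comm (suc n) (toℕ lo)))
  to : ∀ x → P x → InArc (suc n) (suc (toℕ hi)) M (toℕ x)
  to x Px with suc (toℕ hi) ≤? toℕ x
  ... | yes hi<x = inj₁ (hi<x , subst (toℕ x <_) (sym end) (<-≤-trans (toℕ<n x) (m≤n+m (suc n) (toℕ lo))))
  ... | no hi≮x = inj₂ (≰⇒> hi≮x , subst (toℕ x + suc n <_) (sym end) (+-monoˡ-< (suc n)
          (≰⇒> λ lo≤x → between-extrema convex ¬lo ¬hi x lo≤x (≮⇒≥ hi≮x) Px)))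
  from : ∀ x → InArc (suc n) (suc (toℕ hi)) M (toℕ x) → P x
  from x (inj₁ (hi<x , _)) = decidable-stable (P? x) λ ¬x → <⇒≱ hi<x (proj₂ (bd x ¬x))
  from x (inj₂ (_ , x+n<)) = decidable-stable (P? x) λ ¬x →
    <⇒≱ (+-cancelʳ-< (suc n) (toℕ x) (toℕ lo) (subst (toℕ x + suc n <_) end x+n<)) (proj₁ (bd x ¬x))

-- Arc permutations

cpred : ∀ {n} → Fin n → Fin n
cpred {suc n} zero = fromℕ n
cpred (suc i)      = inject₁ i

csuc-cpred : ∀ {n} (j : Fin n) → csuc (cpred j) ≡ j
csuc-cpred {suc n} zero = toℕ-injective (begin
  toℕ (csuc (fromℕ n))            ≡⟨ toℕ-fromℕ< _ ⟩
  suc (toℕ (fromℕ n)) % suc n     ≡⟨ cong (λ s → suc s % suc n) (toℕ-fromℕ n) ⟩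
  suc n % suc n                   ≡⟨ n%n≡0 (suc n) ⟩
  0                               ∎)
  where open ≡-Reasoning
csuc-cpred {suc n} (suc i) = toℕ-injective (begin
  toℕ (csuc (inject₁ i))          ≡⟨ toℕ-fromℕ< _ ⟩
  suc (toℕ (inject₁ i)) % suc n   ≡⟨ cong (λ s → suc s % suc n) (toℕ-inject₁ i) ⟩
  suc (toℕ i) % suc n             ≡⟨ m<n⇒m%n≡m (s≤s (toℕ<n i)) ⟩
  suc (toℕ i)                     ∎)
  where open ≡-Reasoning

cpred-surjective : ∀ {n} (i : Fin n) → ∃ λ j → cpred j ≡ i
cpred-surjective {suc n} i with view i
... | ‵fromℕ     = zero , refl
... | ‵inject₁ j = suc j , refl

lookup-ext : ∀ {A : Set} {n} {u v : Vec A n} → (∀ i → lookup u i ≡ lookup v i) → u ≡ v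
lookup-ext {u = u} {v} eq = trans (sym (tabulate∘lookup u)) (trans (tabulate-cong eq) (tabulate∘lookup v))

value : ∀ {n} → Vec (Fin n) n → Fin n → ℕ
value π i = toℕ (lookup π i)

-- Indexing a descent by its later position `j` lets `cpred` reduce by patterns and keeps `mod` out
-- of everything that follows.
lookup-cDes : ∀ {n} (π : Vec (Fin n) n) j → lookup (cDes π) (cpred j) ≡ (value π j <ᵇ value π (cpred j))
lookup-cDes π j = trans (lookup∘tabulate _ (cpred j)) (cong (λ i → value π i <ᵇ value π (cpred j)) (csuc-cpred j))

cDes-≡ : ∀ {n} (π : Vec (Fin n) n) {S} → (∀ j → (value π j <ᵇ value π (cpred j)) ≡ lookup S (cpred j)) → cDes π ≡ S
cDes-≡ π {S} eq = lookup-ext λ i → subst (λ i → lookup (cDes π) i ≡ lookup S i) (proj₂ (cpred-surjective i))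
  (trans (lookup-cDes π (proj₁ (cpred-surjective i))) (eq _))

Start : ∀ {n} → Subset n → Set
Start {n} S = Σ (Fin n) λ e → lookup S e ≡ true × lookup S (cpred e) ≡ false

Start-≡ : ∀ {n} {S : Subset n} {s t : Start S} → proj₁ s ≡ proj₁ t → s ≡ t
Start-≡ {s = _ , p , q} {_ , p′ , q′} refl rewrite uip p p′ | uip q q′ = refl

≤last : ∀ {n} (i : Fin (suc n)) → toℕ i ≤ toℕ (fromℕ n)
≤last {n} i = subst (toℕ i ≤_) (sym (toℕ-fromℕ n)) (s≤s⁻¹ (toℕ<n i))

inject₁<suc : ∀ {n} (i : Fin n) → toℕ (inject₁ i) < toℕ (Fin.suc i)
inject₁<suc i = s≤s (≤-reflexive (toℕ-inject₁ i))

<suc⇒≤inject₁ : ∀ {n} {i : Fin n} {x} → x < toℕ (Fin.suc i) → x ≤ toℕ (inject₁ i)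
<suc⇒≤inject₁ {i = i} x<j = subst (_ ≤_) (sym (toℕ-inject₁ i)) (s≤s⁻¹ x<j)

-- The comparisons imposed by `(S, e)`. Before `e`, the entry at `j` lies beyond all earlier ones,
-- on the side given by the descent at `cpred j`. After `e`, the entry at `i` lies beyond all later
-- ones, on the side given by the descent at `i`. The wrap-around descent orders the two blocks.
-- With `f` valued in ℕ, a permutation, a key and its ranks can all satisfy it.
record ArcOrder {m} (S : Subset (2+ m)) (e : Fin (2+ m)) (f : Fin (2+ m) → ℕ) : Set where
  field
    top    : ∀ i → i ≢ e → f i < f e
    before : ∀ i j → toℕ i < toℕ j → toℕ j < toℕ e → Dir (not (lookup S (cpred j))) (f i) (f j)
    after  : ∀ i j → toℕ e < toℕ i → toℕ i < toℕ j → Dir (not (lookup S i)) (f i) (f j)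
    across : ∀ i j → toℕ i < toℕ e → toℕ e < toℕ j → Dir (lookup S (fromℕ (suc m))) (f i) (f j)

<⇒≢ᶠ : ∀ {n} {i j : Fin n} → toℕ i < toℕ j → i ≢ j
<⇒≢ᶠ i<j refl = <-irrefl refl i<j

cpred-≢ : ∀ {m} (j : Fin (2+ m)) → j ≢ cpred j
cpred-≢ zero    = λ ()
cpred-≢ (suc i) = <⇒≢ᶠ (inject₁<suc i) ∘ sym

module _ {m} {S : Subset (2+ m)} {e : Fin (2+ m)} where
  open ArcOrder

  ArcOrder-rank : ∀ {f} → ArcOrder S e f → ArcOrder S e (rank f)
  ArcOrder-rank {f} o .top i i≢e = rank-mono-< f (top o i i≢e)
  ArcOrder-rank {f} o .before i j i<j j<e = rank-Dir f (not (lookup S (cpred j))) (before o i j i<j j<e)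
  ArcOrder-rank {f} o .after i j e<i i<j = rank-Dir f (not (lookup S i)) (after o i j e<i i<j)
  ArcOrder-rank {f} o .across i j i<e e<j = rank-Dir f (lookup S (fromℕ (suc m))) (across o i j i<e e<j)

  -- The four fields settle every pair of positions, so `(S, e)` admits only one order pattern.
  ArcOrder⇒SameOrder : ∀ {f g} → ArcOrder S e f → ArcOrder S e g → SameOrder f g
  ArcOrder⇒SameOrder o p i j i<j with <-cmp (toℕ i) (toℕ e) | <-cmp (toℕ j) (toℕ e)
  ... | tri< i<e _ _ | tri< j<e _ _ = _ , before o i j i<j j<e , before p i j i<j j<e
  ... | tri< i<e _ _ | tri> _ _ e<j = _ , across o i j i<e e<j , across p i j i<e e<j
  ... | tri> _ _ e<i | _            = _ , after o i j e<i i<j , after p i j e<i i<j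
  ... | _            | tri≈ _ j≡e _ with refl ← toℕ-injective j≡e = true , top o i (<⇒≢ᶠ i<j) , top p i (<⇒≢ᶠ i<j)
  ... | tri≈ _ i≡e _ | _ with refl ← toℕ-injective i≡e =
    false , top o j (<⇒≢ᶠ i<j ∘ sym) , top p j (<⇒≢ᶠ i<j ∘ sym)

  ArcOrder⇒injective : ∀ {f} → ArcOrder S e f → Inj f
  ArcOrder⇒injective o = SameOrder⇒injective (ArcOrder⇒SameOrder o o)

  -- Adjacent pairs that avoid `e` take their bit from `before`, `after` or, for the wrap-around
  -- pair, `across`. The two pairs at `e` are decided by `top`, and agree with `S` exactly because
  -- `e ∈ S` and `e − 1 ∉ S`.
  ArcOrder⇒cDes : lookup S e ≡ true → lookup S (cpred e) ≡ false →
    ∀ {f} → ArcOrder S e f → ∀ j → (f j <ᵇ f (cpred j)) ≡ lookup S (cpred j)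
  ArcOrder⇒cDes e∈S e-1∉S {f} o j with j Fin.≟ e | cpred j Fin.≟ e
  ... | yes refl | yes eq  = contradiction (trans (sym e∈S) (trans (cong (lookup S) (sym eq)) e-1∉S)) λ ()
  ... | yes refl | no j-1≢e = trans (≤⇒<ᵇ≡false (<⇒≤ (top o (cpred j) j-1≢e))) (sym e-1∉S)
  ... | no j≢e   | yes j-1≡e = trans
        (<⇒<ᵇ≡true (subst (λ i → f j < f i) (sym j-1≡e) (top o j j≢e)))
        (sym (trans (cong (lookup S) j-1≡e) e∈S))
  ArcOrder⇒cDes e∈S e-1∉S {f} o zero | no 0≢e | no last≢e =
    Dir-<ᵇ _ (across o zero _
      (≤∧≢⇒< z≤n (0≢e ∘ toℕ-injective)) (≤∧≢⇒< (≤last e) (last≢e ∘ sym ∘ toℕ-injective)))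
  ArcOrder⇒cDes e∈S e-1∉S {f} o (suc i) | no j≢e | no i≢e with <-cmp (toℕ e) (suc (toℕ i))
  ... | tri≈ _ e≡j _ = contradiction (sym (toℕ-injective e≡j)) j≢e
  ... | tri> _ _ j<e = Dir-<ᵇ _ (subst (λ b → Dir b (f (suc i)) (f (inject₁ i))) (not-involutive _)
                         (Dir-flip (not (lookup S (inject₁ i))) (before o (inject₁ i) (suc i) (inject₁<suc i) j<e)))
  ... | tri< e<j _ _ = Dir-<ᵇ _ (subst (λ b → Dir b (f (suc i)) (f (inject₁ i))) (not-involutive _)
                         (Dir-flip (not (lookup S (inject₁ i))) (after o (inject₁ i) (suc i)
                           (≤∧≢⇒< (<suc⇒≤inject₁ e<j) (i≢e ∘ sym ∘ toℕ-injective)) (inject₁<suc i))))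

Dir-to-between : ∀ b {x y z} → Dir b x y → Dir b z y → x < y → y < z → ⊥
Dir-to-between true  _ d _ y<z = <-asym d y<z
Dir-to-between false d _ x<y _ = <-asym d x<y

Dir-from-between : ∀ b {x y z} → Dir b y x → Dir b y z → x < y → y < z → ⊥
Dir-from-between true  d _ x<y _ = <-asym d x<y
Dir-from-between false _ d _ y<z = <-asym d y<z

-- An arc order makes every prefix a cyclic interval

module _ {m} (π : Vec (Fin (2+ m)) (2+ m)) where
  open ArcOrder

  prefix? : ∀ J x → Dec (prefixSet π J x)
  prefix? J x = any? λ i → (toℕ i <? J) ×-dec (lookup π i Fin.≟ x)

  prefix-∉ : IsPerm π → ∀ {J p} → J ≤ toℕ p → ¬ prefixSet π J (lookup π p)
  prefix-∉ inj {J} {p} J≤p (i , i<J , eq) with refl ← inj i p eq = <⇒≱ i<J J≤p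

  -- `before` and `across` give a position outside the prefix the same direction against every
  -- prefix entry, so its value is never between two of them; the maximum is above them all.
  ArcOrder⇒prefix-convex : ∀ {S e} → ArcOrder S e (value π) → ∀ J → J ≤ toℕ e → Convex (prefixSet π J)
  ArcOrder⇒prefix-convex {S} {e} o J J≤e _ y _ x<y y<z (i , i<J , refl) (k , k<J , refl)
    with injective⇒surjective {f = lookup π} (λ i j eq → ArcOrder⇒injective o i j (cong toℕ eq)) y
  ... | p , refl with toℕ p <? J
  ...   | yes p<J = p , p<J , refl
  ...   | no p≮J with <-cmp (toℕ p) (toℕ e)
  ...     | tri≈ _ p≡e _ with refl ← toℕ-injective p≡e =
              contradiction (top o k λ { refl → <⇒≱ k<J J≤e }) (<-asym y<z)
  ...     | tri< p<e _ _ = ⊥-elim (Dir-to-between _ (before o i p (<-≤-trans i<J (≮⇒≥ p≮J)) p<e)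
                                    (before o k p (<-≤-trans k<J (≮⇒≥ p≮J)) p<e) x<y y<z)
  ...     | tri> _ _ e<p = ⊥-elim (Dir-to-between _ (across o i p (<-≤-trans i<J J≤e) e<p)
                                    (across o k p (<-≤-trans k<J J≤e) e<p) x<y y<z)

  -- Dually, once the maximum is in the prefix, each prefix entry has the same direction against all
  -- positions outside, so the complement is convex.
  ArcOrder⇒prefix-coconvex : ∀ {S e} → ArcOrder S e (value π) → ∀ J → toℕ e < J → Convex (¬_ ∘ prefixSet π J)
  ArcOrder⇒prefix-coconvex {S} {e} o J e<J x y z x<y y<z x∉ z∉ (p , p<J , refl) =
    not-between (surjective x) (surjective z)
    where
    surjective : ∀ y → ∃ λ i → lookup π i ≡ y
    surjective = injective⇒surjective λ i j eq → ArcOrder⇒injective o i j (cong toℕ eq)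
    J≤ : ∀ {i} → ¬ prefixSet π J (lookup π i) → J ≤ toℕ i
    J≤ i∉ = ≮⇒≥ λ i<J → i∉ (_ , i<J , refl)
    not-between : (∃ λ i → lookup π i ≡ x) → (∃ λ k → lookup π k ≡ z) → ⊥
    not-between (i , refl) (k , refl) with <-cmp (toℕ p) (toℕ e)
    ... | tri≈ _ p≡e _ with refl ← toℕ-injective p≡e =
            contradiction (top o k λ { refl → z∉ (k , e<J , refl) }) (<-asym y<z)
    ... | tri< p<e _ _ = Dir-from-between _ (across o p i p<e (<-≤-trans e<J (J≤ x∉)))
                                            (across o p k p<e (<-≤-trans e<J (J≤ z∉))) x<y y<z
    ... | tri> _ _ e<p = Dir-from-between _ (after o p i e<p (<-≤-trans p<J (J≤ x∉)))
                                            (after o p k e<p (<-≤-trans p<J (J≤ z∉))) x<y y<z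

  ArcOrder⇒IsPerm : ∀ {S e} → ArcOrder S e (value π) → IsPerm π
  ArcOrder⇒IsPerm o i j eq = ArcOrder⇒injective o i j (cong toℕ eq)

  ArcOrder⇒IsArc : ∀ {S e} → ArcOrder S e (value π) → IsArc π
  ArcOrder⇒IsArc {e = e} o J _ _ = IsArcSet⇒IsCycInterval (arc (J ≤? toℕ e))
    where
    arc : Dec (J ≤ toℕ e) → IsArcSet (prefixSet π J)
    arc (yes J≤e) = convex⇒IsArcSet (prefix? J) (ArcOrder⇒prefix-convex o J J≤e)
    arc (no J≰e)  = coconvex⇒IsArcSet (prefix? J) (ArcOrder⇒prefix-coconvex o J (≰⇒> J≰e))

-- An arc permutation has the arc order of its descents and its maximum

module _ {m} (π : Vec (Fin (2+ m)) (2+ m)) (inj : IsPerm π) {e} (top-e : lookup π e ≡ fromℕ (suc m)) where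
  open ArcOrder

  value-injective : Inj (value π)
  value-injective i j eq = inj i j (toℕ-injective eq)

  value<top : ∀ i → i ≢ e → value π i < value π e
  value<top i i≢e = ≤∧≢⇒< (subst (λ t → value π i ≤ toℕ t) (sym top-e) (≤last (lookup π i))) (i≢e ∘ value-injective i e)

  cDes-Dir : ∀ j → Dir (lookup (cDes π) (cpred j)) (value π j) (value π (cpred j))
  cDes-Dir j = subst (λ b → Dir b (value π j) (value π (cpred j))) (sym (lookup-cDes π j)) (<ᵇ-Dir (cpred-≢ j ∘ value-injective _ _))

  cDes-Dir-suc : ∀ i → Dir (not (lookup (cDes π) (inject₁ i))) (value π (inject₁ i)) (value π (suc i))
  cDes-Dir-suc i = Dir-flip (lookup (cDes π) (inject₁ i)) (cDes-Dir (suc i))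

  top-isStart : lookup (cDes π) e ≡ true × lookup (cDes π) (cpred e) ≡ false
  top-isStart = top∈ (cpred-surjective e) ,
    trans (lookup-cDes π e) (≤⇒<ᵇ≡false (<⇒≤ (value<top (cpred e) (cpred-≢ e ∘ sym))))
    where
    top∈ : (∃ λ j → cpred j ≡ e) → lookup (cDes π) e ≡ true
    top∈ (j , refl) = trans (lookup-cDes π j) (<⇒<ᵇ≡true (value<top j (cpred-≢ j)))

  module _ (arc : IsArc π) where

    -- The maximum is outside this prefix, so the values at `i`, `j`, `p`, `e` would alternate
    -- between a cyclic interval and its complement.
    prefix-not-between : ∀ {J i p j} → J ≤ toℕ e → toℕ i < J → toℕ p < J → J ≤ toℕ j →
      value π i < value π j → value π j < value π p → ⊥
    prefix-not-between {J} {i} {p} {j} J≤e i<J p<J J≤j i<j j<p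
      with a , s , P⇔ ← IsCycInterval⇒IsArcSet (arc J (≤-<-trans z≤n i<J) (≤-trans J≤e (<⇒≤ (toℕ<n e)))) =
      noncrossing-in-out i<j j<p (value<top p λ { refl → <⇒≱ p<J J≤e }) (toℕ<n (lookup π e))
        (Equivalence.to (P⇔ _) (i , i<J , refl)) (prefix-∉ π inj J≤j ∘ Equivalence.from (P⇔ _))
        (Equivalence.to (P⇔ _) (p , p<J , refl)) (prefix-∉ π inj J≤e ∘ Equivalence.from (P⇔ _))

    suffix-not-between : ∀ {J i p j} → J ≤ 2+ m → toℕ e < J → J ≤ toℕ i → J ≤ toℕ p → toℕ j < J →
      value π i < value π j → value π j < value π p → ⊥
    suffix-not-between {J} {i} {p} {j} J≤n e<J J≤i J≤p j<J i<j j<p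
      with a , s , P⇔ ← IsCycInterval⇒IsArcSet (arc J (≤-<-trans z≤n e<J) J≤n) =
      noncrossing-out-in i<j j<p (value<top p λ { refl → <⇒≱ e<J J≤p })
        (prefix-∉ π inj J≤i ∘ Equivalence.from (P⇔ _)) (Equivalence.to (P⇔ _) (j , j<J , refl))
        (prefix-∉ π inj J≤p ∘ Equivalence.from (P⇔ _)) (Equivalence.to (P⇔ _) (e , e<J , refl))

    -- A later value is not between two prefix values, so a single known comparison with one prefix
    -- entry decides all the others.
    prefix-Dir : ∀ {J i p j} → J ≤ toℕ e → toℕ i < J → toℕ p < J → J ≤ toℕ j →
      ∀ b → Dir b (value π p) (value π j) → Dir b (value π i) (value π j)
    prefix-Dir {J} {i} {p} {j} J≤e i<J p<J J≤j b = Dir-map b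
      (λ p<j → ≤∧≢⇒< (≮⇒≥ λ j<i → prefix-not-between J≤e p<J i<J J≤j p<j j<i) i≢j)
      (λ j<p → ≤∧≢⇒< (≮⇒≥ λ i<j → prefix-not-between J≤e i<J p<J J≤j i<j j<p) (i≢j ∘ sym))
      where
      i≢j : value π i ≢ value π j
      i≢j = <⇒≢ᶠ (<-≤-trans i<J J≤j) ∘ value-injective i j

    suffix-Dir : ∀ {J i p j} → J ≤ 2+ m → toℕ e < J → J ≤ toℕ i → J ≤ toℕ p → toℕ j < J →
      ∀ b → Dir b (value π j) (value π p) → Dir b (value π j) (value π i)
    suffix-Dir {J} {i} {p} {j} J≤n e<J J≤i J≤p j<J b = Dir-map b
      (λ j<p → ≤∧≢⇒< (≮⇒≥ λ i<j → suffix-not-between J≤n e<J J≤i J≤p j<J i<j j<p) (i≢j ∘ sym))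
      (λ p<j → ≤∧≢⇒< (≮⇒≥ λ j<i → suffix-not-between J≤n e<J J≤p J≤i j<J p<j j<i) i≢j)
      where
      i≢j : value π i ≢ value π j
      i≢j = <⇒≢ᶠ (<-≤-trans j<J J≤i) ∘ sym ∘ value-injective i j

    arc⇒ArcOrder : ArcOrder (cDes π) e (value π)
    arc⇒ArcOrder .top = value<top
    arc⇒ArcOrder .before i (suc j) i<j j<e =
      -- The known comparison is the descent bit between the neighbours `inject₁ j` and `suc j`.
      prefix-Dir (<⇒≤ j<e) i<j (inject₁<suc j) ≤-refl _ (cDes-Dir-suc j)
    arc⇒ArcOrder .after i j e<i i<j with view i
    ... | ‵fromℕ      = contradiction (≤last j) (<⇒≱ i<j)
    ... | ‵inject₁ i′ =
      suffix-Dir (toℕ<n (inject₁ i′)) (<-trans e<i ≤-refl) i<j (inject₁<suc i′) ≤-refl _ (cDes-Dir-suc i′)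
    arc⇒ArcOrder .across i j i<e e<j =
      -- The wrap-around bit compares the first entry with the last. It is carried from the first to
      -- `i` inside the prefix before `e`, then from the last to `j` inside the suffix after `e`.
      suffix-Dir (toℕ<n e) ≤-refl e<j e<last (<-trans i<e ≤-refl) _
        (prefix-Dir ≤-refl i<e (≤-<-trans z≤n i<e) (<⇒≤ e<last) _ (cDes-Dir zero))
      where
      e<last : toℕ e < toℕ (fromℕ (suc m))
      e<last = <-≤-trans e<j (≤last j)

-- The arc permutation of a start

module _ {m} (S : Subset (2+ m)) (e : Fin (2+ m)) where
  open ArcOrder

  private
    n : ℕ
    n = 2+ m
    S-last : Bool
    S-last = lookup S (fromℕ (suc m))

  prefixOffset suffixOffset : Fin (2+ m) → ℕ
  prefixOffset i = if lookup S (cpred i) then n ∸ toℕ i else n + toℕ i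
  suffixOffset i = if lookup S i then n + (n ∸ toℕ i) else toℕ i

  -- The offsets used in either block stay below `n + n`, so shifting one block by that amount puts
  -- it wholly above the other and leaves `4n` for the maximum.
  prefixBase suffixBase : Bool → ℕ
  prefixBase b = if b then 0 else n + n
  suffixBase b = prefixBase (not b)

  arcKeyAt : ∀ i → Tri (toℕ i < toℕ e) (toℕ i ≡ toℕ e) (toℕ e < toℕ i) → ℕ
  arcKeyAt i (tri< _ _ _) = prefixBase S-last + prefixOffset i
  arcKeyAt i (tri≈ _ _ _) = (n + n) + (n + n)
  arcKeyAt i (tri> _ _ _) = suffixBase S-last + suffixOffset i

  -- Entries before the maximum spread outwards from n, entries after it close
  -- in on n; the base separates the two blocks.
  arcKey : Fin (2+ m) → ℕ
  arcKey i = arcKeyAt i (<-cmp (toℕ i) (toℕ e))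

  prefixOffset-lower : ∀ i → n ∸ toℕ i ≤ prefixOffset i
  prefixOffset-lower i with lookup S (cpred i)
  ... | true  = ≤-refl
  ... | false = ≤-trans (m∸n≤m n (toℕ i)) (m≤m+n n (toℕ i))

  prefixOffset-upper : ∀ i → prefixOffset i ≤ n + toℕ i
  prefixOffset-upper i with lookup S (cpred i)
  ... | true  = ≤-trans (m∸n≤m n (toℕ i)) (m≤m+n n (toℕ i))
  ... | false = ≤-refl

  suffixOffset-lower : ∀ i → toℕ i ≤ suffixOffset i
  suffixOffset-lower i with lookup S i
  ... | true  = ≤-trans (<⇒≤ (toℕ<n i)) (m≤m+n n _)
  ... | false = ≤-refl

  suffixOffset-upper : ∀ i → suffixOffset i ≤ n + (n ∸ toℕ i)
  suffixOffset-upper i with lookup S i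
  ... | true  = ≤-refl
  ... | false = ≤-trans (<⇒≤ (toℕ<n i)) (m≤m+n n _)

  prefixOffset< : ∀ i → prefixOffset i < n + n
  prefixOffset< i = ≤-<-trans (prefixOffset-upper i) (+-monoʳ-< n (toℕ<n i))

  -- Position 0 could reach `n + n` exactly, but a position after `e` is never 0.
  suffixOffset< : ∀ i → 0 < toℕ i → suffixOffset i < n + n
  suffixOffset< i 0<i = ≤-<-trans (suffixOffset-upper i) (+-monoʳ-< n (∸-monoʳ-< 0<i (<⇒≤ (toℕ<n i))))

  base+< : ∀ b {x} → x < n + n → prefixBase b + x < (n + n) + (n + n)
  base+< true  x< = <-≤-trans x< (m≤m+n (n + n) (n + n))
  base+< false x< = +-monoʳ-< (n + n) x<

  arcKey-ArcOrder : ArcOrder S e arcKey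
  arcKey-ArcOrder .top i i≢e with <-cmp (toℕ i) (toℕ e) | <-cmp (toℕ e) (toℕ e)
  ... | _              | tri< e<e _ _ = contradiction e<e (<-irrefl refl)
  ... | _              | tri> _ _ e<e = contradiction e<e (<-irrefl refl)
  ... | tri< _ _ _     | tri≈ _ _ _ = base+< S-last (prefixOffset< i)
  ... | tri≈ _ i≡e _   | tri≈ _ _ _ = contradiction (toℕ-injective i≡e) i≢e
  ... | tri> _ _ e<i   | tri≈ _ _ _ = base+< (not S-last) (suffixOffset< i (≤-<-trans z≤n e<i))
  arcKey-ArcOrder .before i j i<j j<e with <-cmp (toℕ i) (toℕ e) | <-cmp (toℕ j) (toℕ e)
  ... | tri≈ _ i≡e _ | _ = contradiction (<-trans i<j j<e) (<-irrefl i≡e)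
  ... | tri> _ _ e<i | _ = contradiction e<i (<-asym (<-trans i<j j<e))
  ... | tri< _ _ _ | tri≈ _ j≡e _ = contradiction j<e (<-irrefl j≡e)
  ... | tri< _ _ _ | tri> _ _ e<j = contradiction e<j (<-asym j<e)
  ... | tri< _ _ _ | tri< _ _ _ with lookup S (cpred j)
  ...   | true  = +-monoʳ-< (prefixBase S-last) (<-≤-trans (∸-monoʳ-< i<j (<⇒≤ (toℕ<n j))) (prefixOffset-lower i))
  ...   | false = +-monoʳ-< (prefixBase S-last) (≤-<-trans (prefixOffset-upper i) (+-monoʳ-< n i<j))
  arcKey-ArcOrder .after i j e<i i<j with <-cmp (toℕ i) (toℕ e) | <-cmp (toℕ j) (toℕ e)
  ... | tri≈ _ i≡e _ | _ = contradiction e<i (<-irrefl (sym i≡e))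
  ... | tri< i<e _ _ | _ = contradiction e<i (<-asym i<e)
  ... | tri> _ _ _ | tri≈ _ j≡e _ = contradiction (<-trans e<i i<j) (<-irrefl (sym j≡e))
  ... | tri> _ _ _ | tri< j<e _ _ = contradiction j<e (<-asym (<-trans e<i i<j))
  ... | tri> _ _ _ | tri> _ _ _ with lookup S i
  ...   | true  = +-monoʳ-< (suffixBase S-last) (≤-<-trans (suffixOffset-upper j) (+-monoʳ-< n (∸-monoʳ-< i<j (<⇒≤ (toℕ<n j)))))
  ...   | false = +-monoʳ-< (suffixBase S-last) (<-≤-trans i<j (suffixOffset-lower j))
  arcKey-ArcOrder .across i j i<e e<j with <-cmp (toℕ i) (toℕ e) | <-cmp (toℕ j) (toℕ e)
  ... | tri≈ _ i≡e _ | _ = contradiction i<e (<-irrefl i≡e)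
  ... | tri> _ _ e<i | _ = contradiction e<i (<-asym i<e)
  ... | tri< _ _ _ | tri≈ _ j≡e _ = contradiction e<j (<-irrefl (sym j≡e))
  ... | tri< _ _ _ | tri< j<e _ _ = contradiction j<e (<-asym e<j)
  ... | tri< _ _ _ | tri> _ _ _ with S-last
  ...   | true  = <-≤-trans (prefixOffset< i) (m≤m+n (n + n) _)
  ...   | false = <-≤-trans (suffixOffset< j (≤-<-trans z≤n e<j)) (m≤m+n (n + n) _)

  arcWord : Vec (Fin (2+ m)) (2+ m)
  arcWord = tabulate λ i → fromℕ< (rank<n arcKey i)

  arcWord-ArcOrder : ArcOrder S e (value arcWord)
  arcWord-ArcOrder = ArcOrder-≗ (λ i → sym (trans (cong toℕ (lookup∘tabulate (λ j → fromℕ< (rank<n arcKey j)) i)) (toℕ-fromℕ< (rank<n arcKey i))))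
    (ArcOrder-rank arcKey-ArcOrder)
    where
    ArcOrder-≗ : ∀ {f g} → f ≗ g → ArcOrder S e f → ArcOrder S e g
    ArcOrder-≗ f≗g o .top i i≢e = subst₂ _<_ (f≗g i) (f≗g e) (top o i i≢e)
    ArcOrder-≗ f≗g o .before i j p q = subst₂ (Dir (not (lookup S (cpred j)))) (f≗g i) (f≗g j) (before o i j p q)
    ArcOrder-≗ f≗g o .after i j p q = subst₂ (Dir (not (lookup S i))) (f≗g i) (f≗g j) (after o i j p q)
    ArcOrder-≗ f≗g o .across i j p q = subst₂ (Dir S-last) (f≗g i) (f≗g j) (across o i j p q)

-- The bijection between arc permutations and starts

module _ {m : ℕ} where
  open ArcOrder

  -- Injectivity is an irrelevant field and cannot yield a position; the position comes from a
  -- search, and injectivity only excludes failure.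
  topPosition : (π : ArcPerm (2+ m)) → Σ (Fin (2+ m)) λ e → lookup (perm π) e ≡ fromℕ (suc m)
  topPosition (arcPerm π inj _) with any? (λ i → lookup π i Fin.≟ fromℕ (suc m))
  ... | yes found  = found
  ... | no missing = ⊥-elim-irr (missing (injective⇒surjective inj _))

  arcWord-cDes : ∀ {S : Subset (2+ m)} ((e , _) : Start S) → cDes (arcWord S e) ≡ S
  arcWord-cDes {S} (e , e∈S , e-1∉S) = cDes-≡ (arcWord S e) (ArcOrder⇒cDes e∈S e-1∉S (arcWord-ArcOrder S e))

  arcWord-cDes-inverse : (π : ArcPerm (2+ m)) → arcWord (cDes (perm π)) (proj₁ (topPosition π)) ≡ perm π
  -- Equality of words is decidable, so a proof resting on irrelevant fields can be recomputed.
  arcWord-cDes-inverse p@(arcPerm π inj arc) = recompute (≡-dec Fin._≟_ _ _)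
    (lookup-ext (SameOrder⇒≗ (ArcOrder⇒SameOrder (arcWord-ArcOrder (cDes π) (proj₁ (topPosition p)))
      (arc⇒ArcOrder π inj (proj₂ (topPosition p)) arc))))

  arc↔Start : (S : Subset (2+ m)) → (Σ (ArcPerm (2+ m)) λ π → cDes (perm π) ≡ S) ↔ Start S
  arc↔Start S = mk↔ₛ′ to from to∘from from∘to
    where
    to : (Σ (ArcPerm (2+ m)) λ π → cDes (perm π) ≡ S) → Start S
    to (p@(arcPerm π inj _) , refl) =
      proj₁ (topPosition p) ,
      recompute (_ Bool.≟ _) (proj₁ (top-isStart π inj (proj₂ (topPosition p)))) ,
      recompute (_ Bool.≟ _) (proj₂ (top-isStart π inj (proj₂ (topPosition p))))
    from : Start S → Σ (ArcPerm (2+ m)) λ π → cDes (perm π) ≡ S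
    from s@(e , _) =
      arcPerm (arcWord S e) (ArcOrder⇒IsPerm (arcWord S e) (arcWord-ArcOrder S e)) (ArcOrder⇒IsArc (arcWord S e) (arcWord-ArcOrder S e)) ,
      arcWord-cDes {S} s
    Σ-≡ : {p q : Σ (ArcPerm (2+ m)) λ π → cDes (perm π) ≡ S} → perm (proj₁ p) ≡ perm (proj₁ q) → p ≡ q
    Σ-≡ {arcPerm _ _ _ , c} {arcPerm _ _ _ , d} refl rewrite uip c d = refl
    proj₁-to : ∀ p → proj₁ (to p) ≡ proj₁ (topPosition (proj₁ p))
    proj₁-to (_ , refl) = refl
    to∘from : ∀ s → to (from s) ≡ s
    -- Any other position has a value strictly below that at `e`, yet the position found carries the
    -- greatest value.
    to∘from s@(e , _) = Start-≡ {S = S} (trans (proj₁-to (from s)) (decidable-stable (_ Fin.≟ e) λ e′≢e →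
      <⇒≱ (top (arcWord-ArcOrder S e) _ e′≢e)
          (subst (λ t → value (arcWord S e) e ≤ toℕ t) (sym (proj₂ (topPosition (proj₁ (from s))))) (≤last (lookup (arcWord S e) e)))))
    from∘to : ∀ p → from (to p) ≡ p
    from∘to (π , refl) = Σ-≡ (arcWord-cDes-inverse π)

-- Descents of a tableau from its leg and its extra cell

_==_ : ∀ {n} → Fin n → Fin n → Bool
i == j = does (i Fin.≟ j)

≡⇒≡ᵇ≡true : ∀ {x y} → x ≡ y → (x ≡ᵇ y) ≡ true
≡⇒≡ᵇ≡true {x} {y} x≡y = Equivalence.to T-≡ (≡⇒≡ᵇ x y x≡y)

≢⇒≡ᵇ≡false : ∀ {x y} → x ≢ y → (x ≡ᵇ y) ≡ false
≢⇒≡ᵇ≡false {x} {y} x≢y with x ≡ᵇ y in eq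
... | false = refl
... | true  = contradiction (≡ᵇ⇒≡ x y (Equivalence.from T-≡ eq)) x≢y

-- The descents of a tableau are the leg shifted down by one, together with `e` if `e < n`. Their
-- number is `k`, or `k + 1` when `e < n` and `e + 1` is not in the leg. So the cardinality test for
-- `n` becomes the local conditions `last` and `last-leg`.
record TableauDes {m} (leg : Fin (2+ m) → Bool) (e : Fin (2+ m)) (S : Subset (2+ m)) : Set where
  field
    inner     : ∀ i → lookup S (inject₁ i) ≡ leg (suc i) ∨ (inject₁ i == e)
    last      : e ≡ fromℕ (suc m) → lookup S (fromℕ (suc m)) ≡ true
    last-leg  : ∀ i → e ≡ inject₁ i → lookup S (fromℕ (suc m)) ≡ leg (suc i)
open TableauDes

TableauDes-unique : ∀ {m} {leg leg′ : Fin (2+ m) → Bool} {e S S′} → leg ≗ leg′ →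
  TableauDes leg e S → TableauDes leg′ e S′ → S ≡ S′
TableauDes-unique {m} {leg} {leg′} {e} {S} {S′} leg≗ d d′ = lookup-ext same
  where
  same-last : lookup S (fromℕ (suc m)) ≡ lookup S′ (fromℕ (suc m))
  same-last with view e
  ... | ‵fromℕ     = trans (last d refl) (sym (last d′ refl))
  ... | ‵inject₁ i = trans (last-leg d i refl) (trans (leg≗ (suc i)) (sym (last-leg d′ i refl)))
  same : ∀ i → lookup S i ≡ lookup S′ i
  same i with view i
  ... | ‵fromℕ     = same-last
  ... | ‵inject₁ j = trans (inner d j) (trans (cong (_∨ (inject₁ j == e)) (leg≗ (suc j))) (sym (inner d′ j)))

-- `TableauDes` solved for the leg. Membership of `i` in `S` tells whether `i + 1` is in the leg,
-- except at `i = e`, which is a descent in any case; there the bit at `n` decides.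
legs : ∀ {m} → Subset (2+ m) → Fin (2+ m) → Fin (2+ m) → Bool
legs         S e zero    = false
legs {m = m} S e (suc i) = lookup S (inject₁ i) ∧ (lookup S (fromℕ (suc m)) ∨ not (inject₁ i == e))

TableauDes⇒legs : ∀ {m} {leg : Fin (2+ m) → Bool} {e S} → leg zero ≡ false → TableauDes leg e S → leg ≗ legs S e
TableauDes⇒legs leg₀ d zero = leg₀
TableauDes⇒legs {m} {leg} {e} {S} leg₀ d (suc i) with inject₁ i Fin.≟ e | inner d i
... | no _    | Sᵢ rewrite Sᵢ | ∨-zeroʳ (lookup S (fromℕ (suc m))) | ∨-identityʳ (leg (suc i)) = sym (∧-identityʳ _)
... | yes i≡e | Sᵢ rewrite Sᵢ | ∨-zeroʳ (leg (suc i)) | ∨-identityʳ (lookup S (fromℕ (suc m))) = sym (last-leg d i (sym i≡e))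

module _ {m} (S : Subset (2+ m)) (e : Fin (2+ m)) (e∈S : lookup S e ≡ true) where

  legs-TableauDes : TableauDes (legs S e) e S
  legs-TableauDes .inner i with inject₁ i Fin.≟ e
  ... | yes refl = trans e∈S (sym (∨-zeroʳ _))
  ... | no _ rewrite ∨-zeroʳ (lookup S (fromℕ (suc m))) | ∨-identityʳ (lookup S (inject₁ i) ∧ true) = sym (∧-identityʳ _)
  legs-TableauDes .last refl = e∈S
  legs-TableauDes .last-leg i refl with inject₁ i Fin.≟ inject₁ i
  ... | yes _  rewrite e∈S = sym (∨-identityʳ _)
  ... | no i≢i = contradiction refl i≢i

  module _ (e-1∉S : lookup S (cpred e) ≡ false) where

    legs-extra : legs S e e ≡ false
    legs-extra = none e e-1∉S
      where
      none : ∀ j → lookup S (cpred j) ≡ false → legs S e j ≡ false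
      none zero    _  = refl
      none (suc j) eq rewrite eq = refl

    -- `c` is to fill the corner of the hook. The first entry serves unless it is `e`; then `e − 1`
    -- is the position `n`, whose absence from `S` keeps the second entry out of the leg.
    legs-corner : Σ (Fin (2+ m)) λ c → c ≢ e × legs S e c ≡ false × (∀ i → legs S e i ≡ true → toℕ c < toℕ i)
    legs-corner = corner e e-1∉S
      where
      corner : ∀ d → lookup S (cpred d) ≡ false →
        Σ (Fin (2+ m)) λ c → c ≢ d × legs S d c ≡ false × (∀ i → legs S d i ≡ true → toℕ c < toℕ i)
      corner (suc d) _ = zero , (λ ()) , refl , λ { (suc i) _ → z<s }
      corner zero S-last = suc zero , (λ ()) , leg₁ , λ
        { (suc zero) leg → contradiction (trans (sym leg) leg₁) λ ()
        ; (suc (suc i)) _ → s<s z<s }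
        where
        leg₁ : legs S zero (suc zero) ≡ false
        leg₁ rewrite S-last = ∧-zeroʳ _

    -- Both `e` and the corner stay out of the leg, which bounds `k` by `n − 2`, the end of the
    -- summation range.
    legs-count : # (legs S e) ≤ m
    legs-count with c , c≢e , leg-c , _ ← legs-corner = s≤s⁻¹ (s≤s⁻¹ (≤-trans (s≤s leg<leg+c) leg+c<all))
      where
      leg+c : Fin (2+ m) → Bool
      leg+c i = legs S e i ∨ (i == c)
      leg<leg+c : # (legs S e) < # leg+c
      leg<leg+c = #-mono-< {f = legs S e} {g = leg+c} (λ i eq → cong (_∨ (i == c)) eq) c leg-c
        (trans (cong (legs S e c ∨_) (dec-true (c Fin.≟ c) refl)) (∨-zeroʳ _))
      leg+c<all : # leg+c < 2+ m
      leg+c<all = subst (# leg+c <_) (#-all (2+ m)) (#-mono-< {f = leg+c} (λ _ _ → refl) e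
        (cong₂ _∨_ legs-extra (dec-false (e Fin.≟ c) (c≢e ∘ sym))) refl)

-- Cells of the shape (n-k-1, 1^k) ⊕ (1), numbered row by row

isLeg : ℕ × ℕ → Bool
isLeg (r , _) = 1 <ᵇ r

cellIndex : ℕ → ℕ → ℕ × ℕ → ℕ
cellIndex n k (0    , c) = 0
cellIndex n k (1    , c) = suc c
cellIndex n k (2+ r , c) = n ∸ k + r

cellAt : ℕ → ℕ → ℕ → ℕ × ℕ
cellAt n k zero    = 0 , n ∸ k ∸ 1
cellAt n k (suc v) = if suc v <ᵇ n ∸ k then (1 , v) else (2+ (suc v ∸ (n ∸ k)) , 0)

module _ {m k} (k≤m : k ≤ m) where

  private
    n w : ℕ
    n = 2+ m
    w = n ∸ k

  w≡2+ : w ≡ 2+ (m ∸ k)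
  w≡2+ = +-∸-assoc 2 k≤m

  suc-width : suc (w ∸ 1) ≡ w
  suc-width rewrite w≡2+ = refl

  -- `w` counts the cells outside the leg. Besides the extra cell there is at least the corner,
  -- which has index 1.
  1<w : 1 < w
  1<w rewrite w≡2+ = s<s z<s

  w+k≡n : w + k ≡ n
  w+k≡n = m∸n+n≡m (m≤n⇒m≤o+n 2 k≤m)

  cellIndex-<w : ∀ {x} → InShape n k x → isLeg x ≡ false → cellIndex n k x < w
  cellIndex-<w (inj₁ (refl , _))                      _ = <-trans z<s 1<w
  cellIndex-<w (inj₂ (inj₁ (refl , c<)))              _ = <-≤-trans (s<s c<) (≤-reflexive suc-width)
  cellIndex-<w (inj₂ (inj₂ (s≤s (s≤s z≤n) , _ , _)))  ()

  cellIndex-≥w : ∀ {x} → InShape n k x → isLeg x ≡ true → w ≤ cellIndex n k x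
  cellIndex-≥w (inj₁ (refl , _))                      ()
  cellIndex-≥w (inj₂ (inj₁ (refl , c<)))              ()
  cellIndex-≥w (inj₂ (inj₂ (s≤s (s≤s z≤n) , _ , _)))  _ = m≤m+n w _

  cellIndex<n : ∀ {x} → InShape n k x → cellIndex n k x < n
  cellIndex<n (inj₁ (refl , _))         = z<s
  cellIndex<n s@(inj₂ (inj₁ (refl , _))) = <-≤-trans (cellIndex-<w s refl) (m∸n≤m n k)
  cellIndex<n (inj₂ (inj₂ (s≤s (s≤s z≤n) , s≤s r<k , _))) = <-≤-trans (+-monoʳ-< w r<k) (≤-reflexive w+k≡n)

  cellAt-cellIndex : ∀ {x} → InShape n k x → cellAt n k (cellIndex n k x) ≡ x
  cellAt-cellIndex (inj₁ (refl , refl)) = refl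
  cellAt-cellIndex s@(inj₂ (inj₁ (refl , _))) rewrite <⇒<ᵇ≡true (cellIndex-<w s refl) = refl
  cellAt-cellIndex (inj₂ (inj₂ (s≤s (s≤s {n = r} z≤n) , _ , refl))) = leg (w + r) refl
    where
    -- `cellAt` matches on its argument, so the sum `w + r` is generalised to a variable.
    leg : ∀ v → v ≡ w + r → cellAt n k v ≡ (2+ r , 0)
    leg zero    v≡ = contradiction (<-≤-trans (<-trans z<s 1<w) (m≤m+n w r)) (≤⇒≯ (≤-reflexive (sym v≡)))
    leg (suc v) v≡ rewrite ≤⇒<ᵇ≡false (≤-trans (m≤m+n w r) (≤-reflexive (sym v≡))) =
      cong (λ r → 2+ r , 0) (trans (cong (_∸ w) v≡) (m+n∸m≡n w r))

  cellIndex-injective : ∀ {x y} → InShape n k x → InShape n k y → cellIndex n k x ≡ cellIndex n k y → x ≡ y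
  cellIndex-injective sx sy eq =
    trans (sym (cellAt-cellIndex sx)) (trans (cong (cellAt n k) eq) (cellAt-cellIndex sy))

  cellAt-arm : ∀ {v} → 0 < v → v < w → cellAt n k v ≡ (1 , pred v)
  cellAt-arm {suc v} _ v<w rewrite <⇒<ᵇ≡true v<w = refl

  cellAt-leg : ∀ {v} → w ≤ v → cellAt n k v ≡ (2+ (v ∸ w) , 0)
  cellAt-leg {zero}  w≤0 = contradiction (<-trans z<s 1<w) (≤⇒≯ w≤0)
  cellAt-leg {suc v} w≤v rewrite ≤⇒<ᵇ≡false w≤v = refl

  row≡0⇒cellIndex≡0 : ∀ {x} → proj₁ x ≡ 0 → cellIndex n k x ≡ 0
  row≡0⇒cellIndex≡0 refl = refl

  cellIndex≡0⇒row≡0 : ∀ {x} → cellIndex n k x ≡ 0 → proj₁ x ≡ 0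
  cellIndex≡0⇒row≡0 {0    , _} _  = refl
  cellIndex≡0⇒row≡0 {2+ r , _} eq =
    contradiction (<-≤-trans (<-trans z<s 1<w) (m≤m+n w r)) (≤⇒≯ (≤-reflexive eq))

  cellIndex≡1⇒corner : ∀ {x} → cellIndex n k x ≡ 1 → x ≡ (1 , 0)
  cellIndex≡1⇒corner {1    , _} refl = refl
  cellIndex≡1⇒corner {2+ r , _} eq   = contradiction (<-≤-trans 1<w (m≤m+n w r)) (≤⇒≯ (≤-reflexive eq))

-- Sorting by this key lists the entries in the order of their cells: the extra one, the arm
-- increasingly, then the leg increasingly, lifted above the arm by `n`.
tabKey : ∀ {n} → (Fin n → Bool) → Fin n → Fin n → ℕ
tabKey {n} leg e i = if i == e then 0 else (if leg i then n + suc (toℕ i) else suc (toℕ i))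

tabKey-extra : ∀ {n} (leg : Fin n → Bool) e → tabKey leg e e ≡ 0
tabKey-extra leg e rewrite dec-true (e Fin.≟ e) refl = refl

tabKey-arm : ∀ {n} (leg : Fin n → Bool) {e i} → i ≢ e → leg i ≡ false → tabKey leg e i ≡ suc (toℕ i)
tabKey-arm leg {e} {i} i≢e leg-i rewrite dec-false (i Fin.≟ e) i≢e | leg-i = refl

tabKey-leg : ∀ {n} (leg : Fin n → Bool) {e i} → i ≢ e → leg i ≡ true → tabKey leg e i ≡ n + suc (toℕ i)
tabKey-leg leg {e} {i} i≢e leg-i rewrite dec-false (i Fin.≟ e) i≢e | leg-i = refl

tabKey-pos : ∀ {n} (leg : Fin n → Bool) {e i} → i ≢ e → tabKey leg e e < tabKey leg e i
tabKey-pos {n} leg {e} {i} i≢e rewrite tabKey-extra leg e | dec-false (i Fin.≟ e) i≢e with leg i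
... | false = z<s
... | true  = <-≤-trans z<s (m≤n+m (suc (toℕ i)) n)

tabKey-arm<leg : ∀ {n} (leg : Fin n → Bool) {e i j} → i ≢ e → j ≢ e → leg i ≡ false → leg j ≡ true →
  tabKey leg e i < tabKey leg e j
tabKey-arm<leg {n} leg {e} {i} {j} i≢e j≢e leg-i leg-j =
  subst₂ _<_ (sym (tabKey-arm leg i≢e leg-i)) (sym (tabKey-leg leg j≢e leg-j))
    (≤-<-trans (toℕ<n i) (m<m+n n z<s))

tabKey-same : ∀ {n} (leg : Fin n → Bool) {e i j} b → i ≢ e → j ≢ e → leg i ≡ b → leg j ≡ b →
  toℕ i < toℕ j → tabKey leg e i < tabKey leg e j
tabKey-same leg false i≢e j≢e leg-i leg-j i<j =
  subst₂ _<_ (sym (tabKey-arm leg i≢e leg-i)) (sym (tabKey-arm leg j≢e leg-j)) (s<s i<j)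
tabKey-same {n} leg true i≢e j≢e leg-i leg-j i<j =
  subst₂ _<_ (sym (tabKey-leg leg i≢e leg-i)) (sym (tabKey-leg leg j≢e leg-j)) (+-monoʳ-< n (s<s i<j))

tabKey-cong : ∀ {n} {leg leg′ : Fin n → Bool} → leg ≗ leg′ → ∀ e → tabKey leg e ≗ tabKey leg′ e
tabKey-cong leg≗ e i rewrite leg≗ i = refl

rowAt-lookup : ∀ {n} (p : Vec (ℕ × ℕ) n) i → rowAt p (toℕ i) ≡ proj₁ (lookup p i)
rowAt-lookup (x ∷ p) zero    = refl
rowAt-lookup (x ∷ p) (suc i) = rowAt-lookup p i

#-init : ∀ {n} (f : Fin (suc n) → Bool) → f (fromℕ n) ≡ false → # f ≡ # (f ∘ inject₁)
#-init {zero}  f eq rewrite eq = refl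
#-init {suc n} f eq with f zero
... | false = #-init (f ∘ suc) eq
... | true  = cong suc (#-init (f ∘ suc) eq)

-- The data carried by a tableau

module Tableau {m k} (k≤m : k ≤ m) (T : SYT (2+ m) k)
  -- The fields of `SYT` are irrelevant. As ordinary arguments they allow case analysis; for an
  -- arbitrary tableau the results are later recovered by decidability.
  (shape : ∀ i → InShape (2+ m) k (lookup (pos T) i))
  (dist  : ∀ i j → lookup (pos T) i ≡ lookup (pos T) j → i ≡ j)
  (rows  : ∀ i j → toℕ i < toℕ j → proj₁ (lookup (pos T) i) ≡ proj₁ (lookup (pos T) j) →
           proj₂ (lookup (pos T) i) < proj₂ (lookup (pos T) j))
  (cols  : ∀ i j → toℕ i < toℕ j → proj₂ (lookup (pos T) i) ≡ proj₂ (lookup (pos T) j) →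
           proj₁ (lookup (pos T) i) < proj₁ (lookup (pos T) j))
  where

  private
    n w : ℕ
    n = 2+ m
    w = n ∸ k

  row col : Fin (2+ m) → ℕ
  row i = proj₁ (lookup (pos T) i)
  col i = proj₂ (lookup (pos T) i)

  leg : Fin (2+ m) → Bool
  leg i = isLeg (lookup (pos T) i)

  idx : Fin (2+ m) → ℕ
  idx i = cellIndex (2+ m) k (lookup (pos T) i)

  index : Fin (2+ m) → Fin (2+ m)
  index i = fromℕ< (cellIndex<n k≤m (shape i))

  toℕ-index : ∀ i → toℕ (index i) ≡ idx i
  toℕ-index i = toℕ-fromℕ< (cellIndex<n k≤m (shape i))

  idx-injective : Inj idx
  idx-injective i j eq = dist i j (cellIndex-injective k≤m (shape i) (shape j) eq)

  index-injective : Inj index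
  index-injective i j eq = idx-injective i j (trans (sym (toℕ-index i)) (trans (cong toℕ eq) (toℕ-index j)))

  idx-surjective : ∀ {v} → v < 2+ m → ∃ λ i → idx i ≡ v
  idx-surjective v<n with injective⇒surjective index-injective (fromℕ< v<n)
  ... | i , eq = i , trans (sym (toℕ-index i)) (trans (cong toℕ eq) (toℕ-fromℕ< v<n))

  extra : ∃ λ e → row e ≡ 0
  extra with idx-surjective {0} z<s
  ... | e , eq = e , cellIndex≡0⇒row≡0 k≤m eq

  -- `index` permutes `Fin n`, and the cells outside the leg are those of index below `w`; hence `w`
  -- entries avoid the leg.
  leg-count : # leg ≡ k
  leg-count = +-cancelˡ-≡ w (# leg) k (begin
    w + # leg                                          ≡⟨ cong (_+ # leg) (sym arm-count) ⟩
    # (not ∘ leg) + # leg                              ≡⟨ #-not leg ⟩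
    n                                                  ≡⟨ w+k≡n k≤m ⟨
    w + k                                              ∎)
    where
    open ≡-Reasoning
    arm : ∀ i → not (leg i) ≡ (toℕ (index i) <ᵇ w)
    arm i rewrite toℕ-index i with leg i in leg-i
    ... | false = sym (<⇒<ᵇ≡true (cellIndex-<w k≤m (shape i) leg-i))
    ... | true  = sym (≤⇒<ᵇ≡false (cellIndex-≥w k≤m (shape i) leg-i))
    arm-count : # (not ∘ leg) ≡ w
    arm-count = trans (#-cong arm) (trans (#-permute index-injective (λ v → toℕ v <ᵇ w)) (#-initial w (m∸n≤m n k)))

  row-leg : ∀ {i} → leg i ≡ true → 1 < row i
  row-leg = <ᵇ≡true⇒<

  col-leg : ∀ {i} → leg i ≡ true → col i ≡ 0
  col-leg {i} leg-i with shape i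
  ... | inj₁ (r≡0 , _)          = contradiction (subst (1 <_) r≡0 (row-leg leg-i)) λ ()
  ... | inj₂ (inj₁ (r≡1 , _))   = contradiction (subst (1 <_) r≡1 (row-leg leg-i)) λ { (s≤s ()) }
  ... | inj₂ (inj₂ (_ , _ , c≡0)) = c≡0

  -- The corner heads the column that holds the leg.
  after-corner : ∃ λ c → row c ≡ 1 × (∀ i → leg i ≡ true → toℕ c < toℕ i)
  after-corner with idx-surjective {1} (s<s z<s)
  ... | c , idx≡1 = c , cong proj₁ pos-c , later
    where
    pos-c : lookup (pos T) c ≡ (1 , 0)
    pos-c = cellIndex≡1⇒corner k≤m idx≡1
    later : ∀ i → leg i ≡ true → toℕ c < toℕ i
    later i leg-i with <-cmp (toℕ c) (toℕ i)
    ... | tri< c<i _ _ = c<i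
    ... | tri≈ _ c≡i _ with refl ← toℕ-injective c≡i =
            contradiction (subst (1 <_) (cong proj₁ pos-c) (row-leg leg-i)) λ { (s≤s ()) }
    ... | tri> _ _ i<c = contradiction
            (subst (row i <_) (cong proj₁ pos-c) (cols i c i<c (trans (col-leg leg-i) (sym (cong proj₂ pos-c)))))
            (<-asym (row-leg leg-i))

  leg-zero : leg zero ≡ false
  leg-zero with leg zero in leg₀
  ... | false = refl
  ... | true with c , _ , later ← after-corner = contradiction (later zero leg₀) λ ()

  module _ {e} (row-e : row e ≡ 0) where

    row≡0⇒≡e : ∀ i → row i ≡ 0 → i ≡ e
    row≡0⇒≡e i row-i = idx-injective i e
      (trans (row≡0⇒cellIndex≡0 k≤m row-i) (sym (row≡0⇒cellIndex≡0 k≤m row-e)))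

    row-arm : ∀ {i} → i ≢ e → leg i ≡ false → row i ≡ 1
    row-arm {i} i≢e leg-i = ≤-antisym
      (≮⇒≥ λ 1<row → contradiction (trans (sym (<⇒<ᵇ≡true 1<row)) leg-i) λ ())
      (n≢0⇒n>0 (i≢e ∘ row≡0⇒≡e i))

    leg-extra : leg e ≡ false
    leg-extra rewrite row-e = refl

    -- The corner's entry would have to precede the second entry, but the only earlier one occupies
    -- the extra cell.
    leg-one : e ≡ zero → leg (suc zero) ≡ false
    leg-one refl with leg (suc zero) in leg₁
    ... | false = refl
    ... | true with after-corner
    ...   | zero  , row-c , _     = contradiction (trans (sym row-e) row-c) λ ()
    ...   | suc c , _     , later = contradiction (later (suc zero) leg₁) λ { (s≤s ()) }

    -- The extra cell is alone in the top row, so any step from it goes down. Any other descent must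
    -- end in the leg, and every step into the leg is one: it comes from the row above the leg or
    -- from higher in column 0.
    row-descent : ∀ i → (row (inject₁ i) <ᵇ row (suc i)) ≡ leg (suc i) ∨ (inject₁ i == e)
    row-descent i with inject₁ i Fin.≟ e
    ... | yes i≡e = trans (<⇒<ᵇ≡true (subst (_< row (suc i)) (sym (trans (cong row i≡e) row-e))
                      (n≢0⇒n>0 λ row≡0 → <⇒≢ᶠ (inject₁<suc i) (trans i≡e (sym (row≡0⇒≡e (suc i) row≡0))))))
                      (sym (∨-zeroʳ _))
    ... | no i≢e rewrite ∨-identityʳ (leg (suc i)) with leg (suc i) in leg-i⁺
    ...   | false = ≤⇒<ᵇ≡false (≤-trans row-i⁺≤1 (n≢0⇒n>0 (i≢e ∘ row≡0⇒≡e (inject₁ i))))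
      where
      row-i⁺≤1 : row (suc i) ≤ 1
      row-i⁺≤1 = ≮⇒≥ λ 1<row → contradiction (trans (sym (<⇒<ᵇ≡true 1<row)) leg-i⁺) λ ()
    ...   | true with leg (inject₁ i) in leg-i
    ...     | true  = <⇒<ᵇ≡true (cols (inject₁ i) (suc i) (inject₁<suc i) (trans (col-leg leg-i) (sym (col-leg leg-i⁺))))
    ...     | false = <⇒<ᵇ≡true (subst (_< row (suc i)) (sym (row-arm i≢e leg-i)) (row-leg leg-i⁺))

    lookup-DesT : ∀ i → lookup (DesT T) i ≡ (suc (toℕ i) <ᵇ n) ∧ (rowAt (pos T) (toℕ i) <ᵇ rowAt (pos T) (suc (toℕ i)))
    lookup-DesT = lookup∘tabulate λ i → (suc (toℕ i) <ᵇ n) ∧ (rowAt (pos T) (toℕ i) <ᵇ rowAt (pos T) (suc (toℕ i)))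

    lookup-cDesT : ∀ i → lookup (cDesT T) i ≡ lookup (DesT T) i ∨ ((suc (toℕ i) ≡ᵇ n) ∧ (∣ DesT T ∣ ≡ᵇ k))
    lookup-cDesT = lookup∘tabulate λ i → lookup (DesT T) i ∨ ((suc (toℕ i) ≡ᵇ n) ∧ (∣ DesT T ∣ ≡ᵇ k))

    DesT-inner : ∀ i → lookup (DesT T) (inject₁ i) ≡ leg (suc i) ∨ (inject₁ i == e)
    DesT-inner i = begin
      lookup (DesT T) (inject₁ i)
        ≡⟨ lookup-DesT (inject₁ i) ⟩
      (suc (toℕ (inject₁ i)) <ᵇ n) ∧ (rowAt (pos T) (toℕ (inject₁ i)) <ᵇ rowAt (pos T) (suc (toℕ (inject₁ i))))
        ≡⟨ cong₂ _∧_ (<⇒<ᵇ≡true (s<s (subst (_< suc m) (sym (toℕ-inject₁ i)) (toℕ<n i))))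
             (cong₂ _<ᵇ_ (rowAt-lookup (pos T) (inject₁ i))
               (trans (cong (rowAt (pos T) ∘ suc) (toℕ-inject₁ i)) (rowAt-lookup (pos T) (suc i)))) ⟩
      (row (inject₁ i) <ᵇ row (suc i))
        ≡⟨ row-descent i ⟩
      leg (suc i) ∨ (inject₁ i == e) ∎
      where open ≡-Reasoning

    DesT-last : lookup (DesT T) (fromℕ (suc m)) ≡ false
    DesT-last = trans (lookup-DesT (fromℕ (suc m)))
      (cong (_∧ (rowAt (pos T) (toℕ (fromℕ (suc m))) <ᵇ rowAt (pos T) (suc (toℕ (fromℕ (suc m)))))) (≤⇒<ᵇ≡false (s≤s (≤-reflexive (sym (toℕ-fromℕ (suc m)))))))

    DesT-count : ∣ DesT T ∣ ≡ # (λ i → leg (suc i) ∨ (inject₁ i == e))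
    DesT-count = trans (cong ∣_∣ (sym (tabulate∘lookup (DesT T))))
      (trans (#-init (lookup (DesT T)) DesT-last) (#-cong DesT-inner))

    leg-suc-count : # (leg ∘ suc) ≡ k
    leg-suc-count = trans (sym (drop leg-zero)) leg-count
      where
      drop : leg zero ≡ false → # leg ≡ # (leg ∘ suc)
      drop leg₀ rewrite leg₀ = refl

    cDesT-last : lookup (cDesT T) (fromℕ (suc m)) ≡ (∣ DesT T ∣ ≡ᵇ k)
    cDesT-last = trans (lookup-cDesT (fromℕ (suc m)))
      (cong₂ _∨_ DesT-last (cong (_∧ (∣ DesT T ∣ ≡ᵇ k)) (≡⇒≡ᵇ≡true (cong suc (toℕ-fromℕ (suc m))))))

    cDesT-TableauDes : TableauDes leg e (cDesT T)
    cDesT-TableauDes .inner i = trans (lookup-cDesT (inject₁ i)) (trans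
      (cong₂ _∨_ (DesT-inner i) (cong (_∧ (∣ DesT T ∣ ≡ᵇ k))
        (≢⇒≡ᵇ≡false (<⇒≢ (s<s (subst (_< suc m) (sym (toℕ-inject₁ i)) (toℕ<n i)))))))
      (∨-identityʳ _))
    cDesT-TableauDes .last refl = trans cDesT-last (≡⇒≡ᵇ≡true (trans DesT-count (trans (#-cong same) leg-suc-count)))
      where
      same : ∀ i → leg (suc i) ∨ (inject₁ i == fromℕ (suc m)) ≡ leg (suc i)
      same i = trans (cong (leg (suc i) ∨_) (dec-false (inject₁ i Fin.≟ fromℕ (suc m)) (Fin.fromℕ≢inject₁ ∘ sym)))
                     (∨-identityʳ _)
    cDesT-TableauDes .last-leg i refl with leg (suc i) in leg-i⁺
    -- The descent `e` is already counted through `e + 1` in the leg, so there are still `k`; in the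
    -- other case it is an additional one.
    ... | true = trans cDesT-last (≡⇒≡ᵇ≡true (trans DesT-count (trans (#-cong same) leg-suc-count)))
      where
      same : ∀ j → leg (suc j) ∨ (inject₁ j == inject₁ i) ≡ leg (suc j)
      same j with inject₁ j Fin.≟ inject₁ i
      ... | yes eq rewrite Fin.inject₁-injective eq | leg-i⁺ = refl
      ... | no _   = ∨-identityʳ _
    ... | false = trans cDesT-last (≢⇒≡ᵇ≡false λ eq → <⇒≢ more (trans leg-suc-count (trans (sym eq) DesT-count)))
      where
      more : # (leg ∘ suc) < # (λ j → leg (suc j) ∨ (inject₁ j == inject₁ i))
      more = #-mono-< {f = leg ∘ suc} {g = λ j → leg (suc j) ∨ (inject₁ j == inject₁ i)} (λ j eq → cong (_∨ (inject₁ j == inject₁ i)) eq) i leg-i⁺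
        (trans (cong (leg (suc i) ∨_) (dec-true (inject₁ i Fin.≟ inject₁ i) refl)) (∨-zeroʳ _))

    extra-isStart : lookup (cDesT T) e ≡ true × lookup (cDesT T) (cpred e) ≡ false
    extra-isStart = member , previous e refl
      where
      member : lookup (cDesT T) e ≡ true
      member with view e
      ... | ‵fromℕ     = last cDesT-TableauDes refl
      ... | ‵inject₁ i = trans (inner cDesT-TableauDes i)
              (trans (cong (leg (suc i) ∨_) (dec-true (inject₁ i Fin.≟ inject₁ i) refl)) (∨-zeroʳ _))
      previous : ∀ j → e ≡ j → lookup (cDesT T) (cpred j) ≡ false
      previous zero    e≡0 = trans (last-leg cDesT-TableauDes zero e≡0) (leg-one e≡0)
      previous (suc i) refl = trans (inner cDesT-TableauDes i)
        (cong₂ _∨_ leg-extra (dec-false (inject₁ i Fin.≟ suc i) (<⇒≢ᶠ (inject₁<suc i))))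

    leg≗legs : leg ≗ legs (cDesT T) e
    leg≗legs = TableauDes⇒legs leg-zero cDesT-TableauDes

    -- Row and column increase make entries grow with the cell index along the arm and along the
    -- leg; the blocks themselves are ordered by construction.
    tabKey-sameOrder : SameOrder (tabKey leg e) idx
    tabKey-sameOrder i j i<j = agree (i Fin.≟ e) (j Fin.≟ e) (leg i) (leg j) refl refl
      where
      idx-extra< : ∀ {i} → i ≢ e → idx e < idx i
      idx-extra< i≢e = subst (_< _) (sym (row≡0⇒cellIndex≡0 k≤m row-e))
        (n≢0⇒n>0 λ eq → i≢e (row≡0⇒≡e _ (cellIndex≡0⇒row≡0 k≤m eq)))
      idx-arm<leg : ∀ {i j} → leg i ≡ false → leg j ≡ true → idx i < idx j
      idx-arm<leg {i} {j} leg-i leg-j =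
        <-≤-trans (cellIndex-<w k≤m (shape i) leg-i) (cellIndex-≥w k≤m (shape j) leg-j)
      along-arm : ∀ x y → proj₁ x ≡ 1 → proj₁ y ≡ 1 → proj₂ x < proj₂ y → cellIndex n k x < cellIndex n k y
      along-arm _ _ refl refl = s<s
      along-leg : ∀ x y → 1 < proj₁ x → proj₁ x < proj₁ y → cellIndex n k x < cellIndex n k y
      along-leg _ _ (s≤s (s≤s z≤n)) (s≤s (s≤s r<s)) = +-monoʳ-< w r<s
      agree : Dec (i ≡ e) → Dec (j ≡ e) → ∀ bᵢ bⱼ → leg i ≡ bᵢ → leg j ≡ bⱼ →
        ∃ λ b → Dir b (tabKey leg e i) (tabKey leg e j) × Dir b (idx i) (idx j)
      agree (yes refl) _ _ _ _ _ = true , tabKey-pos leg (<⇒≢ᶠ i<j ∘ sym) , idx-extra< (<⇒≢ᶠ i<j ∘ sym)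
      agree (no i≢e) (yes refl) _ _ _ _ = false , tabKey-pos leg i≢e , idx-extra< i≢e
      agree (no i≢e) (no j≢e) false true  leg-i leg-j =
        true , tabKey-arm<leg leg i≢e j≢e leg-i leg-j , idx-arm<leg leg-i leg-j
      agree (no i≢e) (no j≢e) true  false leg-i leg-j =
        false , tabKey-arm<leg leg j≢e i≢e leg-j leg-i , idx-arm<leg leg-j leg-i
      agree (no i≢e) (no j≢e) false false leg-i leg-j =
        true , tabKey-same leg false i≢e j≢e leg-i leg-j i<j ,
        along-arm (lookup (pos T) i) (lookup (pos T) j) (row-arm i≢e leg-i) (row-arm j≢e leg-j)
          (rows i j i<j (trans (row-arm i≢e leg-i) (sym (row-arm j≢e leg-j))))
      agree (no i≢e) (no j≢e) true  true  leg-i leg-j =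
        true , tabKey-same leg true i≢e j≢e leg-i leg-j i<j ,
        along-leg (lookup (pos T) i) (lookup (pos T) j) (row-leg leg-i)
          (cols i j i<j (trans (col-leg leg-i) (sym (col-leg leg-j))))

    pos-determined : ∀ i → lookup (pos T) i ≡ cellAt (2+ m) k (rank (tabKey (legs (cDesT T) e) e) i)
    pos-determined i = sym (begin
      cellAt n k (rank (tabKey (legs (cDesT T) e) e) i)
        ≡⟨ cong (cellAt n k) (#-cong λ j → cong₂ _<ᵇ_ (tabKey-cong leg≗legs e j) (tabKey-cong leg≗legs e i)) ⟨
      cellAt n k (rank (tabKey leg e) i)
        ≡⟨ cong (cellAt n k) (rank-cong tabKey-sameOrder i) ⟩
      cellAt n k (rank idx i)
        ≡⟨ cong (cellAt n k) (#-cong λ j → cong₂ _<ᵇ_ (toℕ-index j) (toℕ-index i)) ⟨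
      cellAt n k (rank (toℕ ∘ index) i)
        ≡⟨ cong (cellAt n k) (trans (rank-perm index-injective i) (toℕ-index i)) ⟩
      cellAt n k (idx i)
        ≡⟨ cellAt-cellIndex k≤m (shape i) ⟩
      lookup (pos T) i ∎)
      where open ≡-Reasoning

-- The tableau of a start

module FromStart {m} {S : Subset (2+ m)} {e} (e∈S : lookup S e ≡ true) (e-1∉S : lookup S (cpred e) ≡ false)
  -- `k` is kept abstract with an equation because the sum supplies it as `toℕ` of an element of
  -- `Fin`.
  {k} (k≡ : # (legs S e) ≡ k) where

  private
    n w : ℕ
    n = 2+ m
    w = n ∸ k
    leg : Fin (2+ m) → Bool
    leg = legs S e
    key : Fin (2+ m) → ℕ
    key = tabKey leg e
    leg-e : leg e ≡ false
    leg-e = legs-extra S e e∈S e-1∉S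
    k≤m : k ≤ m
    k≤m = subst (_≤ m) k≡ (legs-count S e e∈S e-1∉S)

  place : Fin (2+ m) → ℕ
  place = rank (tabKey (legs S e) e)

  tabPos : Vec (ℕ × ℕ) (2+ m)
  tabPos = tabulate λ i → cellAt (2+ m) k (place i)

  arm-count : # (not ∘ leg) ≡ w
  arm-count = trans (sym (m+n∸n≡m (# (not ∘ leg)) (# leg))) (cong₂ _∸_ (#-not leg) k≡)

  leg⇒≢e : ∀ i → leg i ≡ true → i ≢ e
  leg⇒≢e i leg-i refl = contradiction (trans (sym leg-i) leg-e) λ ()

  place-extra : place e ≡ 0
  place-extra = trans (#-cong λ j → cong (key j <ᵇ_) (tabKey-extra leg e)) (#-none n)

  place-pos : ∀ {i} → i ≢ e → 0 < place i
  place-pos {i} i≢e = ≤-<-trans z≤n (rank-mono-< key {e} {i} (tabKey-pos leg i≢e))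

  place-leg : ∀ i → leg i ≡ true → w ≤ place i
  place-leg i leg-i = subst (_≤ place i) arm-count (#-mono {f = not ∘ leg} below)
    where
    below : ∀ j → not (leg j) ≡ true → (key j <ᵇ key i) ≡ true
    below j not-leg-j = <⇒<ᵇ≡true (key< (j Fin.≟ e))
      where
      key< : Dec (j ≡ e) → key j < key i
      key< (yes refl) = tabKey-pos leg (leg⇒≢e i leg-i)
      key< (no j≢e)   = tabKey-arm<leg leg j≢e (leg⇒≢e i leg-i)
        (trans (sym (not-involutive (leg j))) (cong not not-leg-j)) leg-i

  -- Every entry with a smaller key avoids the leg, and so does `i` itself, so the rank is below the
  -- number `w` of such entries.
  place-arm : ∀ i → leg i ≡ false → place i < w
  place-arm i leg-i = subst (place i <_) arm-count
    (#-mono-< {g = not ∘ leg} below i (≤⇒<ᵇ≡false (≤-refl {key i})) (cong not leg-i))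
    where
    below : ∀ j → (key j <ᵇ key i) ≡ true → not (leg j) ≡ true
    below j key< = not-leg (leg j) refl
      where
      key≮ : leg j ≡ true → Dec (i ≡ e) → ¬ key j < key i
      key≮ leg-j (yes refl) = <-asym (tabKey-pos leg (leg⇒≢e j leg-j))
      key≮ leg-j (no i≢e)   = <-asym (tabKey-arm<leg leg i≢e (leg⇒≢e j leg-j) leg-i leg-j)
      not-leg : ∀ b → leg j ≡ b → not b ≡ true
      not-leg false _     = refl
      not-leg true  leg-j = contradiction (<ᵇ≡true⇒< {key j} key<) (key≮ leg-j (i Fin.≟ e))

  -- Ties an entry to its cell, so that the tableau conditions are checked by cases on two kinds
  -- instead of through `cellAt`.
  data Kind (i : Fin (2+ m)) : ℕ × ℕ → Set where
    inExtra : i ≡ e → Kind i (0 , n ∸ k ∸ 1)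
    inArm   : ∀ {c} → i ≢ e → leg i ≡ false → place i ≡ suc c → c < n ∸ k ∸ 1 → Kind i (1 , c)
    inLeg   : ∀ {r} → leg i ≡ true → place i ≡ w + r → r < k → Kind i (2+ r , 0)

  kind : ∀ i → Kind i (lookup tabPos i)
  kind i = subst (Kind i) (sym (lookup∘tabulate (λ j → cellAt n k (place j)) i)) (at (i Fin.≟ e) (leg i) refl)
    where
    at : Dec (i ≡ e) → ∀ b → leg i ≡ b → Kind i (cellAt n k (place i))
    at (yes refl) _ _ = subst (Kind i) (sym (cong (cellAt n k) place-extra)) (inExtra refl)
    at (no i≢e) false leg-i = subst (Kind i) (sym (cellAt-arm k≤m (place-pos i≢e) (place-arm i leg-i)))
      (inArm i≢e leg-i suc-pred-place (s<s⁻¹ (subst₂ _<_ suc-pred-place (sym (suc-width k≤m)) (place-arm i leg-i))))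
      where
      suc-pred-place : place i ≡ suc (pred (place i))
      suc-pred-place = sym (suc-pred (place i) {{>-nonZero (place-pos i≢e)}})
    at (no i≢e) true leg-i = subst (Kind i) (sym (cellAt-leg k≤m (place-leg i leg-i)))
      (inLeg leg-i (sym (m+[n∸m]≡n (place-leg i leg-i))) (+-cancelˡ-< w _ _ (subst₂ _<_ (sym (m+[n∸m]≡n (place-leg i leg-i))) (sym (w+k≡n k≤m)) (rank<n key i))))

  row-extra : proj₁ (lookup tabPos e) ≡ 0
  row-extra with lookup tabPos e | kind e
  ... | _ | inExtra _       = refl
  ... | _ | inArm e≢e _ _ _ = contradiction refl e≢e
  ... | _ | inLeg leg-e′ _ _ = contradiction refl (leg⇒≢e _ leg-e′)

  isLeg-tabPos : ∀ i → isLeg (lookup tabPos i) ≡ leg i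
  isLeg-tabPos i with lookup tabPos i | kind i
  ... | _ | inExtra refl      = sym leg-e
  ... | _ | inArm _ leg-i _ _ = sym leg-i
  ... | _ | inLeg leg-i _ _   = sym leg-i

  place-mono : ∀ b {i j} → i ≢ e → j ≢ e → leg i ≡ b → leg j ≡ b → toℕ i < toℕ j → place i < place j
  place-mono b {i} {j} i≢e j≢e leg-i leg-j i<j = rank-mono-< key {i} {j} (tabKey-same leg b i≢e j≢e leg-i leg-j i<j)

  -- The arm meets the leg's column only at the corner. An arm entry after a leg entry also comes
  -- after `c`, so it is not the first in its row.
  corner-first : ∀ {i j} → toℕ i < toℕ j → leg i ≡ true → j ≢ e → leg j ≡ false → place j ≢ 1
  corner-first {i} {j} i<j leg-i j≢e leg-j place≡1
    with c , c≢e , leg-c , c<leg ← legs-corner S e e∈S e-1∉S =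
    <⇒≱ (subst (place c <_) place≡1 (place-mono false c≢e j≢e leg-c leg-j (<-trans (c<leg i leg-i) i<j)))
        (place-pos c≢e)

  kind-shape : ∀ {i x} → Kind i x → InShape (2+ m) k x
  kind-shape (inExtra _)       = inj₁ (refl , refl)
  kind-shape (inArm _ _ _ c<)  = inj₂ (inj₁ (refl , c<))
  kind-shape (inLeg _ _ r<k)   = inj₂ (inj₂ (s≤s (s≤s z≤n) , s≤s r<k , refl))

  kind-row : ∀ {i j x y} → toℕ i < toℕ j → Kind i x → Kind j y → proj₁ x ≡ proj₁ y → proj₂ x < proj₂ y
  kind-row i<j (inExtra refl) (inExtra refl) _ = contradiction i<j (<-irrefl refl)
  kind-row i<j (inArm i≢e leg-i pᵢ _) (inArm j≢e leg-j pⱼ _) _ =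
    s<s⁻¹ (subst₂ _<_ pᵢ pⱼ (place-mono false i≢e j≢e leg-i leg-j i<j))
  kind-row i<j (inLeg leg-i pᵢ _) (inLeg leg-j pⱼ _) refl =
    contradiction (trans pᵢ (sym pⱼ)) (<⇒≢ (place-mono true (leg⇒≢e _ leg-i) (leg⇒≢e _ leg-j) leg-i leg-j i<j))

  -- Keeps the extra cell out of the leg's column.
  width≢0 : 0 ≢ n ∸ k ∸ 1
  width≢0 eq = contradiction (1<w k≤m) (≤⇒≯ (≤-reflexive (trans (sym (suc-width k≤m)) (cong suc (sym eq)))))

  kind-col : ∀ {i j x y} → toℕ i < toℕ j → Kind i x → Kind j y → proj₂ x ≡ proj₂ y → proj₁ x < proj₁ y
  kind-col i<j (inExtra refl) (inExtra refl)  _  = contradiction i<j (<-irrefl refl)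
  kind-col i<j (inExtra _)    (inArm _ _ _ _) _  = z<s
  kind-col i<j (inExtra _)    (inLeg _ _ _)   _  = z<s
  kind-col i<j (inArm _ _ _ c<) (inExtra _)   eq = contradiction c< (<-irrefl eq)
  kind-col i<j (inArm i≢e leg-i pᵢ _) (inArm j≢e leg-j pⱼ _) refl =
    contradiction (trans pᵢ (sym pⱼ)) (<⇒≢ (place-mono false i≢e j≢e leg-i leg-j i<j))
  kind-col i<j (inArm _ _ _ _) (inLeg _ _ _)  _  = s<s z<s
  kind-col i<j (inLeg _ _ _) (inExtra _)      eq = contradiction eq width≢0
  kind-col i<j (inLeg leg-i _ _) (inArm j≢e leg-j pⱼ _) refl = contradiction pⱼ (corner-first i<j leg-i j≢e leg-j)
  kind-col i<j (inLeg leg-i pᵢ _) (inLeg leg-j pⱼ _) _ = s<s (s<s (+-cancelˡ-< w _ _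
    (subst₂ _<_ pᵢ pⱼ (place-mono true (leg⇒≢e _ leg-i) (leg⇒≢e _ leg-j) leg-i leg-j i<j))))

  tabPos-row : ∀ i j → toℕ i < toℕ j → proj₁ (lookup tabPos i) ≡ proj₁ (lookup tabPos j) →
    proj₂ (lookup tabPos i) < proj₂ (lookup tabPos j)
  tabPos-row i j i<j = kind-row i<j (kind i) (kind j)

  tabPos-col : ∀ i j → toℕ i < toℕ j → proj₂ (lookup tabPos i) ≡ proj₂ (lookup tabPos j) →
    proj₁ (lookup tabPos i) < proj₁ (lookup tabPos j)
  tabPos-col i j i<j = kind-col i<j (kind i) (kind j)

  tabPos-distinct : ∀ i j → lookup tabPos i ≡ lookup tabPos j → i ≡ j
  tabPos-distinct i j eq with <-cmp (toℕ i) (toℕ j)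
  ... | tri≈ _ i≡j _ = toℕ-injective i≡j
  ... | tri< i<j _ _ = contradiction (tabPos-row i j i<j (cong proj₁ eq)) (<-irrefl (cong proj₂ eq))
  ... | tri> _ _ j<i = contradiction (tabPos-row j i j<i (cong proj₁ (sym eq))) (<-irrefl (cong proj₂ (sym eq)))

  tableau : SYT (2+ m) k
  tableau = syt tabPos (kind-shape ∘ kind) tabPos-distinct tabPos-row tabPos-col

  module Facts = Tableau k≤m tableau (kind-shape ∘ kind) tabPos-distinct tabPos-row tabPos-col

  -- Both sets satisfy the `TableauDes` conditions for the same leg and the same `e`, and these have
  -- only one solution.
  tableau-cDes : cDesT tableau ≡ S
  tableau-cDes = TableauDes-unique isLeg-tabPos (Facts.cDesT-TableauDes row-extra) (legs-TableauDes S e e∈S)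

-- The bijection between tableaux and starts

SYT-≡ : ∀ {n k} {T T′ : SYT n k} → pos T ≡ pos T′ → T ≡ T′
SYT-≡ {T = syt _ _ _ _ _} {syt _ _ _ _ _} refl = refl

module _ {m k} (k≤m : k ≤ m) where

  extraEntry : (T : SYT (2+ m) k) → ∃ λ e → proj₁ (lookup (pos T) e) ≡ 0
  extraEntry T@(syt p sh di ro co) with any? (λ i → proj₁ (lookup p i) ≟ 0)
  ... | yes found  = found
  ... | no missing = ⊥-elim-irr (missing (Tableau.extra k≤m T sh di ro co))

  extraEntry-isStart : (T : SYT (2+ m) k) → let e = proj₁ (extraEntry T) in
    lookup (cDesT T) e ≡ true × lookup (cDesT T) (cpred e) ≡ false
  extraEntry-isStart T@(syt p sh di ro co) =
    recompute (_ Bool.≟ _) (proj₁ (Tableau.extra-isStart k≤m T sh di ro co (proj₂ (extraEntry T)))) ,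
    recompute (_ Bool.≟ _) (proj₂ (Tableau.extra-isStart k≤m T sh di ro co (proj₂ (extraEntry T))))

  extraEntry-unique : (T : SYT (2+ m) k) {e : Fin (2+ m)} → proj₁ (lookup (pos T) e) ≡ 0 → proj₁ (extraEntry T) ≡ e
  extraEntry-unique T@(syt p sh di ro co) {e} row-e =
    recompute (_ Fin.≟ _) (Tableau.row≡0⇒≡e k≤m T sh di ro co row-e _ (proj₂ (extraEntry T)))

  -- Recovers the summation index `k` itself from the descent set and the extra entry.
  legs-count-SYT : (T : SYT (2+ m) k) → # (legs (cDesT T) (proj₁ (extraEntry T))) ≡ k
  legs-count-SYT T@(syt p sh di ro co) = recompute (_ ≟ _) (trans
    (sym (#-cong (Tableau.leg≗legs k≤m T sh di ro co (proj₂ (extraEntry T)))))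
    (Tableau.leg-count k≤m T sh di ro co))

  pos-determined-SYT : (T : SYT (2+ m) k) →
    pos T ≡ tabulate λ i → cellAt (2+ m) k (rank (tabKey (legs (cDesT T) (proj₁ (extraEntry T))) (proj₁ (extraEntry T))) i)
  pos-determined-SYT T@(syt p sh di ro co) = recompute (≡-dec (Product.≡-dec _≟_ _≟_) _ _)
    (trans (sym (tabulate∘lookup p))
      (tabulate-cong (Tableau.pos-determined k≤m T sh di ro co (proj₂ (extraEntry T)))))

SYT↔Start : ∀ {m} (S : Subset (2+ m)) →
  (Σ (Fin (suc m)) λ k → Σ (SYT (2+ m) (toℕ k)) λ T → cDesT T ≡ S) ↔ Start S
SYT↔Start {m} S = mk↔ₛ′ to from to∘from from∘to
  where
  Tableaux : Set
  Tableaux = Σ (Fin (suc m)) λ k → Σ (SYT (2+ m) (toℕ k)) λ T → cDesT T ≡ S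
  bound : (k : Fin (suc m)) → toℕ k ≤ m
  bound = toℕ≤pred[n]
  to : Tableaux → Start S
  to (k , T , refl) = proj₁ (extraEntry (bound k) T) , extraEntry-isStart (bound k) T
  size : Start S → Fin (suc m)
  size (e , p , q) = fromℕ< (s≤s (legs-count S e p q))
  size-count : (s : Start S) → # (legs S (proj₁ s)) ≡ toℕ (size s)
  size-count (e , p , q) = sym (toℕ-fromℕ< (s≤s (legs-count S e p q)))
  from : Start S → Tableaux
  from s@(e , p , q) =
    size s , FromStart.tableau {S = S} p q (size-count s) , FromStart.tableau-cDes {S = S} p q (size-count s)
  Tableaux-≡ : ∀ {x y : Tableaux} → toℕ (proj₁ x) ≡ toℕ (proj₁ y) → pos (proj₁ (proj₂ x)) ≡ pos (proj₁ (proj₂ y)) → x ≡ y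
  Tableaux-≡ {_ , T , c} {_ , T′ , d} k≡k′ pos≡
    with refl ← toℕ-injective k≡k′ with refl ← SYT-≡ {T = T} {T′} pos≡ rewrite uip c d = refl
  proj₁-to : ∀ x → proj₁ (to x) ≡ proj₁ (extraEntry (bound (proj₁ x)) (proj₁ (proj₂ x)))
  proj₁-to (_ , _ , refl) = refl
  to∘from : ∀ s → to (from s) ≡ s
  to∘from s@(e , p , q) = Start-≡ {S = S} (trans (proj₁-to (from s))
    (extraEntry-unique (bound (size s)) (proj₁ (proj₂ (from s))) (FromStart.row-extra {S = S} p q (size-count s))))
  from∘to : ∀ x → from (to x) ≡ x
  -- The rebuilt tableau is laid out with `size (to x)` in place of `k`, so its cells are first
  -- transported along `size≡k`.
  from∘to x@(k , T , refl) = Tableaux-≡ size≡k (trans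
    (tabulate-cong λ i → cong (λ k → cellAt (2+ m) k (rank (tabKey (legs S e) e) i)) size≡k)
    (sym (pos-determined-SYT (bound k) T)))
    where
    e = proj₁ (extraEntry (bound k) T)
    size≡k : toℕ (size (to x)) ≡ toℕ k
    size≡k = trans (sym (size-count (to x))) (legs-count-SYT (bound k) T)

theorem6p11 : (n : ℕ) → 2 ≤ n → (S : Subset n) →
    (Σ (ArcPerm n) λ π → cDes (perm π) ≡ S)
    ↔ (Σ (Fin (n ∸ 1)) λ k → Σ (SYT n (toℕ k)) λ T → cDesT T ≡ S)
theorem6p11 (2+ m) (s≤s (s≤s z≤n)) S = ↔-sym (SYT↔Start S) ↔-∘ arc↔Start S
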